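{- For all integers $s > r \ge 2$ there exists a constant $n_{r,s}$ such that for all $n \ge n_{r,s}$, $$\mathrm{sat}(n, K_r, K_s) = (n-s+2)\binom{s-2}{r-1} + \binom{s-2}{r}.$$ Moreover, there exists a constant $c_{r,s} > 0$ such that (for all $n \ge n_{r,s}$) the only $n$-vertex $K_s$-saturated graph with at most $\mathrm{sat}(n, K_r, K_s) + c_{r,s} n$ copies of $K_r$ is $K_{s-2} \ast \overline{K}_{n-s+2}$.
   Context: A graph $G$ is $F$-saturated if $G$ contains no subgraph isomorphic to $F$, but adding any edge (between two non-adjacent vertices) to $G$ creates a copy of $F$. For graphs $H,F$, $\mathrm{sat}(n,H,F)$ denotes the minimum number of copies of $H$ in an $n$-vertex $F$-saturated graph. $K_t$ is the complete graph on $t$ vertices and $\overline{K}_t$ the edgeless graph on $t$ vertices. The join $G_1 \ast G_2$ is the disjoint union of $G_1$ and $G_2$ together with all edges between $V(G_1)$ and $V(G_2)$. -}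

module Defs where

open import Data.Nat.Base using (ℕ; zero; suc; _+_; _*_; _∸_; _≡ᵇ_; _<ᵇ_; _≤_)
open import Data.Bool.Base using (Bool; true; false; _∧_; _∨_; not; if_then_else_)
open import Data.Fin.Base using (Fin; toℕ)
open import Data.Fin.Properties using (_≟_)
open import Data.Fin.Subset using (Subset; inside; outside; ∣_∣)
open import Data.Vec.Base using (Vec; []; _∷_; lookup)
open import Data.List.Base using (List; []; _∷_; map; _++_; allFin)
open import Data.Bool.ListAction using (all)
open import Data.Nat.ListAction using (sum)
open import Data.Product.Base using (Σ; _×_)
open import Relation.Nullary using (¬_; does)
open import Relation.Binary.PropositionalEquality using (_≡_; _≢_)

Adj : ℕ → Set
Adj n = Fin n → Fin n → Bool

record IsSimple {n : ℕ} (A : Adj n) : Set where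
  field
    symmetric  : ∀ i j → A i j ≡ A j i
    irreflexive : ∀ i → A i i ≡ false

allSubsets : (n : ℕ) → List (Subset n)
allSubsets zero = [] ∷ []
allSubsets (suc n) = map (outside ∷_) (allSubsets n) ++ map (inside ∷_) (allSubsets n)

isCliqueᵇ : {n : ℕ} → Adj n → Subset n → Bool
isCliqueᵇ {n} A p =
  all (λ i → all (λ j → not (lookup p i ∧ lookup p j) ∨ does (i ≟ j) ∨ A i j) (allFin n)) (allFin n)

copiesK : {n : ℕ} → ℕ → Adj n → ℕ
copiesK {n} r A = sum (map (λ p → if (∣ p ∣ ≡ᵇ r) ∧ isCliqueᵇ A p then 1 else 0) (allSubsets n))

ContainsK : {n : ℕ} → ℕ → Adj n → Set
ContainsK {n} s A = Σ (Subset n) λ p → (∣ p ∣ ≡ s) × (isCliqueᵇ A p ≡ true)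

addEdge : {n : ℕ} → Adj n → Fin n → Fin n → Adj n
addEdge A u v i j =
  A i j ∨ (does (i ≟ u) ∧ does (j ≟ v)) ∨ (does (i ≟ v) ∧ does (j ≟ u))

Saturated : {n : ℕ} → ℕ → Adj n → Set
Saturated s A =
  IsSimple A × (¬ ContainsK s A) ×
  (∀ u v → u ≢ v → A u v ≡ false → ContainsK s (addEdge A u v))

IsSat : ℕ → ℕ → ℕ → ℕ → Set
IsSat n r s m =
  (Σ (Adj n) λ A → Saturated s A × (copiesK r A ≡ m)) ×
  (∀ (A : Adj n) → Saturated s A → m ≤ copiesK r A)

Isomorphic : {n : ℕ} → Adj n → Adj n → Set
Isomorphic {n} A B =
  Σ (Fin n → Fin n) λ f → Σ (Fin n → Fin n) λ g →
    (∀ x → g (f x) ≡ x) × (∀ y → f (g y) ≡ y) × (∀ i j → A i j ≡ B (f i) (f j))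

-- K_k * \bar K_{n-k} on Fin n: vertices with index < k form the clique K_k,
-- the remaining n - k vertices are independent, and all clique-to-rest edges
-- are present.
joinCliqueIndep : (n k : ℕ) → Adj n
joinCliqueIndep n k i j = not (does (i ≟ j)) ∧ ((toℕ i <ᵇ k) ∨ (toℕ j <ᵇ k))

{-# OPTIONS --safe #-}

-- Write t = s - 2 and c = C(t, r-1), and let G be K_s-saturated; two non-adjacent
-- vertices have a K_t in their common neighbourhood.
--
-- (1) If some vertex w lies in a K_{t+1} = w ∪ T containing all copies of K_r at w,
-- then G = K_t * \bar K_{n-t} with clique part T. A non-neighbour x of w shares a
-- K_t with w, which must be T, so x is joined to T. If a neighbour x ∉ T missed some
-- y ∈ T, then the common K_t of x and y would have at most one vertex not adjacent to
-- w, and the rest of it would give a copy of K_r through w and x.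
--
-- (2) Greedily pick pairwise adjacent vertices lying in at most rc copies of K_r,
-- each outside the set M of all vertices sharing a copy of K_r with the earlier ones.
-- This stops after at most r steps, so |M| is bounded independently of n. Afterwards
-- every vertex w ∉ M in at most rc copies of K_r misses a chosen vertex v, and the
-- common K_t of v and w lies in M.
--
-- (3) Hence w is in at least c copies of K_r whose other vertices are in M, and,
-- unless (1) applies, in a further copy. Let every copy of K_r distribute a total
-- weight of at most r over its vertices outside M, giving r to a single such vertex
-- and 1 to each of several. Each vertex outside M receives at least rc + 1, so G has
-- at least (n - |M|)(c + 1/r) copies of K_r, which for large n exceeds the number in
-- K_t * \bar K_{n-t} by more than n/(2r).

module Submission where

open import Defs
open import Data.Bool.Base using (Bool; true; false; T; not; _∧_; _∨_; if_then_else_)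
open import Data.Bool.Properties using (T-≡; T?; ∨-zeroʳ; ∨-comm) renaming (_≟_ to _≟ᴮ_)
open import Data.Empty using (⊥-elim)
open import Data.Fin.Base using (Fin; zero; suc; toℕ; fromℕ; punchIn)
open import Data.Fin.Permutation using (Permutation′; _⟨$⟩ʳ_; _⟨$⟩ˡ_; lift₀; insert; inverseˡ; inverseʳ) renaming (id to idₚ)
open import Data.Fin.Properties using (_≟_; any?; toℕ-fromℕ)
open import Data.Fin.Subset using (Subset; inside; outside; ∣_∣; _∈_; _∉_; _⊆_; _⊈_; _∪_; _∩_; ∁; ⁅_⁆; ⊥; ⋃)
open import Data.Fin.Subset.Properties
open import Data.List.Base using (List; []; _∷_; _++_; map; filter; allFin)
open import Data.List.Membership.Propositional using () renaming (_∈_ to _∈ᴸ_)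
open import Data.List.Membership.Propositional.Properties using (∈-map⁺; ∈-++⁺ˡ; ∈-++⁺ʳ; ∈-filter⁺)
open import Data.List.Properties using (map-++; map-∘; map-cong)
open import Data.List.Relation.Unary.All.Properties using (all⁺; all⁻; tabulate⁺; tabulate⁻)
open import Data.List.Relation.Unary.Any using (here; there)
open import Data.Nat.Base using (ℕ; zero; suc; _+_; _*_; _∸_; _≤_; _<_; z≤n; s≤s; _<ᵇ_)
open import Data.Nat.Combinatorics using (_C_; nCk+nC[k+1]≡[n+1]C[k+1]; nCk≡nC[n∸k]; nCn≡1; k>n⇒nCk≡0)
open import Data.Nat.ListAction using (sum)
open import Data.Nat.ListAction.Properties using (sum-++)
open import Data.Nat.Properties as ℕ using (≤-refl; ≤-trans; ≤-reflexive; module ≤-Reasoning)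
open import Algebra.Properties.Semiring.Sum ℕ.+-*-semiring using (*-distribˡ-sum; *-distribʳ-sum) renaming (sum to Σᶠ)
open import Data.Nat.Tactic.RingSolver using (solve-∀)
open import Data.Product.Base using (Σ; ∃; _×_; _,_; proj₁; proj₂)
open import Data.Sum.Base using (_⊎_; inj₁; inj₂)
open import Data.Vec.Base using ([]; _∷_; lookup; here; there; tabulate)
open import Data.Vec.Properties using ([]=⇒lookup; lookup⇒[]=; lookup∘tabulate)
open import Function.Base using (_∘_; id)
open import Function.Bundles using (Equivalence; mk⇔)
open import Relation.Binary.PropositionalEquality using (_≡_; _≢_; refl; sym; trans; cong; cong₂; subst; module ≡-Reasoning)
open import Relation.Nullary using (¬_; Dec; yes; no; does; contradiction; _×-dec_; ¬?)
open import Relation.Nullary.Decidable using (map′; dec-true; dec-false; decidable-stable; does-⇔)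

private
  variable
    n : ℕ
    x y : Fin n
    p q : Subset n

-- Finite subsets

∣p∪q∣≤∣p∣+∣q∣ : ∀ (p q : Subset n) → ∣ p ∪ q ∣ ≤ ∣ p ∣ + ∣ q ∣
∣p∪q∣≤∣p∣+∣q∣ []            []            = z≤n
∣p∪q∣≤∣p∣+∣q∣ (outside ∷ p) (outside ∷ q) = ∣p∪q∣≤∣p∣+∣q∣ p q
∣p∪q∣≤∣p∣+∣q∣ (outside ∷ p) (inside ∷ q)  = ≤-trans (s≤s (∣p∪q∣≤∣p∣+∣q∣ p q)) (≤-reflexive (sym (ℕ.+-suc _ _)))
∣p∪q∣≤∣p∣+∣q∣ (inside ∷ p)  (outside ∷ q) = s≤s (∣p∪q∣≤∣p∣+∣q∣ p q)
∣p∪q∣≤∣p∣+∣q∣ (inside ∷ p)  (inside ∷ q)  = s≤s (≤-trans (∣p∪q∣≤∣p∣+∣q∣ p q) (ℕ.+-monoʳ-≤ ∣ p ∣ (ℕ.n≤1+n _)))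

∣p∣≤∣q∣+∣p∩∁q∣ : ∀ (p q : Subset n) → ∣ p ∣ ≤ ∣ q ∣ + ∣ p ∩ ∁ q ∣
∣p∣≤∣q∣+∣p∩∁q∣ p q = ≤-trans (p⊆q⇒∣p∣≤∣q∣ sub) (∣p∪q∣≤∣p∣+∣q∣ q (p ∩ ∁ q))
  where
  sub : p ⊆ q ∪ (p ∩ ∁ q)
  sub {x} x∈p with x ∈? q
  ... | yes x∈q = x∈p∪q⁺ (inj₁ x∈q)
  ... | no  x∉q = x∈p∪q⁺ (inj₂ (x∈p∩q⁺ (x∈p , x∉p⇒x∈∁p x∉q)))

x∈⁅x⁆∪p : ∀ (x : Fin n) (p : Subset n) → x ∈ ⁅ x ⁆ ∪ p
x∈⁅x⁆∪p x p = x∈p∪q⁺ (inj₁ (x∈⁅x⁆ x))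

y∈⁅x⁆∪p⁻ : ∀ (x : Fin n) (p : Subset n) → y ∈ ⁅ x ⁆ ∪ p → y ≡ x ⊎ y ∈ p
y∈⁅x⁆∪p⁻ x p y∈ with x∈p∪q⁻ ⁅ x ⁆ p y∈
... | inj₁ y∈⁅x⁆ = inj₁ (x∈⁅y⁆⇒x≡y x y∈⁅x⁆)
... | inj₂ y∈p   = inj₂ y∈p

∣⁅x⁆∪p∣≤1+∣p∣ : ∀ (x : Fin n) (p : Subset n) → ∣ ⁅ x ⁆ ∪ p ∣ ≤ suc ∣ p ∣
∣⁅x⁆∪p∣≤1+∣p∣ x p = ≤-trans (∣p∪q∣≤∣p∣+∣q∣ ⁅ x ⁆ p) (≤-reflexive (cong (_+ ∣ p ∣) (∣⁅x⁆∣≡1 x)))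

x∉p⇒∣⁅x⁆∪p∣≡1+∣p∣ : ∀ {x : Fin n} {p : Subset n} → x ∉ p → ∣ ⁅ x ⁆ ∪ p ∣ ≡ suc ∣ p ∣
x∉p⇒∣⁅x⁆∪p∣≡1+∣p∣ {x = x} {p} x∉p = ℕ.≤-antisym (∣⁅x⁆∪p∣≤1+∣p∣ x p)
  (p⊂q⇒∣p∣<∣q∣ (q⊆p∪q ⁅ x ⁆ p , x , x∈⁅x⁆∪p x p , x∉p))

⊆∧∣∣≥⇒⊇ : p ⊆ q → ∣ q ∣ ≤ ∣ p ∣ → q ⊆ p
⊆∧∣∣≥⇒⊇ {p = p} p⊆q ∣q∣≤∣p∣ {x} x∈q with x ∈? p
... | yes x∈p = x∈p
... | no  x∉p = contradiction ∣q∣≤∣p∣ (ℕ.<⇒≱ (p⊂q⇒∣p∣<∣q∣ (p⊆q , x , x∈q , x∉p)))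

subsetBetween : ∀ (p q : Subset n) k → p ⊆ q → ∣ p ∣ ≤ k → k ≤ ∣ q ∣ →
  ∃ λ m → p ⊆ m × m ⊆ q × ∣ m ∣ ≡ k
subsetBetween []            []            zero    p⊆q _ _ = [] , id , id , refl
subsetBetween (inside ∷ p)  (outside ∷ q) k       p⊆q _ _ = contradiction (p⊆q here) λ ()
subsetBetween (outside ∷ p) (outside ∷ q) k       p⊆q a b =
  let m , p⊆m , m⊆q , ∣m∣ = subsetBetween p q k (drop-∷-⊆ p⊆q) a b
  in outside ∷ m , s⊆s p⊆m , s⊆s m⊆q , ∣m∣
subsetBetween (inside ∷ p)  (inside ∷ q)  (suc k) p⊆q (s≤s a) (s≤s b) =
  let m , p⊆m , m⊆q , ∣m∣ = subsetBetween p q k (drop-∷-⊆ p⊆q) a b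
  in inside ∷ m , s⊆s p⊆m , s⊆s m⊆q , cong suc ∣m∣
subsetBetween (outside ∷ p) (inside ∷ q)  k       p⊆q a b with k ℕ.≤? ∣ q ∣
... | yes k≤ =
  let m , p⊆m , m⊆q , ∣m∣ = subsetBetween p q k (drop-∷-⊆ p⊆q) a k≤
  in outside ∷ m , s⊆s p⊆m , out⊆ m⊆q , ∣m∣
-- Here `k` exceeds the size of the tail of `q`, so `k` is one more than it: the head and the whole
-- tail are taken.
... | no k≰ =
  let m , p⊆m , m⊆q , ∣m∣ = subsetBetween p q ∣ q ∣ (drop-∷-⊆ p⊆q) (p⊆q⇒∣p∣≤∣q∣ (drop-∷-⊆ p⊆q)) ≤-refl
  in inside ∷ m , out⊆ p⊆m , s⊆s m⊆q , trans (cong suc ∣m∣) (ℕ.≤-antisym (ℕ.≰⇒> k≰) b)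

∣p∣≤1⇒x≡y : ∣ p ∣ ≤ 1 → x ∈ p → y ∈ p → x ≡ y
∣p∣≤1⇒x≡y {p = p} {x} {y} ∣p∣≤1 x∈p y∈p with x ≟ y
... | yes x≡y = x≡y
... | no  x≢y = contradiction (≤-trans (≤-reflexive (sym two)) (≤-trans (p⊆q⇒∣p∣≤∣q∣ sub) ∣p∣≤1)) λ { (s≤s ()) }
  where
  two : ∣ ⁅ x ⁆ ∪ ⁅ y ⁆ ∣ ≡ 2
  two = trans (x∉p⇒∣⁅x⁆∪p∣≡1+∣p∣ (x≢y⇒x∉⁅y⁆ x≢y)) (cong suc (∣⁅x⁆∣≡1 y))
  sub : ⁅ x ⁆ ∪ ⁅ y ⁆ ⊆ p
  sub z∈ with y∈⁅x⁆∪p⁻ x ⁅ y ⁆ z∈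
  ... | inj₁ refl = x∈p
  ... | inj₂ z∈⁅y⁆ with refl ← x∈⁅y⁆⇒x≡y y z∈⁅y⁆ = y∈p

x≡y⇒∣p∣≤1 : ∀ {p : Subset n} → (∀ {x y} → x ∈ p → y ∈ p → x ≡ y) → ∣ p ∣ ≤ 1
x≡y⇒∣p∣≤1 {n} {p} uniq with nonempty? p
... | yes (x , x∈p) = ≤-trans (p⊆q⇒∣p∣≤∣q∣ {q = ⁅ x ⁆} λ y∈p → subst (_∈ ⁅ x ⁆) (uniq x∈p y∈p) (x∈⁅x⁆ x)) (≤-reflexive (∣⁅x⁆∣≡1 x))
... | no  empty with refl ← Empty-unique empty = ≤-trans (≤-reflexive (∣⊥∣≡0 n)) z≤n

⋃-upper : ∀ {ps : List (Subset n)} → p ∈ᴸ ps → p ⊆ ⋃ ps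
⋃-upper (here refl)  x∈p = x∈p∪q⁺ (inj₁ x∈p)
⋃-upper (there p∈ps) x∈p = x∈p∪q⁺ (inj₂ (⋃-upper p∈ps x∈p))

∈-allSubsets : ∀ (p : Subset n) → p ∈ᴸ allSubsets n
∈-allSubsets []            = here refl
∈-allSubsets (outside ∷ p) = ∈-++⁺ˡ (∈-map⁺ (outside ∷_) (∈-allSubsets p))
∈-allSubsets (inside ∷ p)  = ∈-++⁺ʳ _ (∈-map⁺ (inside ∷_) (∈-allSubsets p))

-- Sums over subsets

𝟙 : ∀ {P : Set} → Dec P → ℕ
𝟙 P? = if does P? then 1 else 0

𝟙-mono : ∀ {P Q : Set} (P? : Dec P) (Q? : Dec Q) → (P → Q) → 𝟙 P? ≤ 𝟙 Q?
𝟙-mono (no _)  _       _ = z≤n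
𝟙-mono (yes _) (yes _) _ = ≤-refl
𝟙-mono (yes a) (no ¬b) f = contradiction (f a) ¬b

𝟙-cong : ∀ {P Q : Set} (P? : Dec P) (Q? : Dec Q) → (P → Q) → (Q → P) → 𝟙 P? ≡ 𝟙 Q?
𝟙-cong P? Q? f g = ℕ.≤-antisym (𝟙-mono P? Q? f) (𝟙-mono Q? P? g)

𝟙-yes : ∀ {P : Set} (P? : Dec P) → P → 𝟙 P? ≡ 1
𝟙-yes (yes _) _ = refl
𝟙-yes (no ¬a) a = contradiction a ¬a

𝟙-no : ∀ {P : Set} (P? : Dec P) → ¬ P → 𝟙 P? ≡ 0
𝟙-no (no _)  _  = refl
𝟙-no (yes a) ¬a = contradiction a ¬a

Σₛ : (Subset n → ℕ) → ℕ
Σₛ {n} f = sum (map f (allSubsets n))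

Σₛ-suc : ∀ (f : Subset (suc n) → ℕ) → Σₛ f ≡ Σₛ (f ∘ (outside ∷_)) + Σₛ (f ∘ (inside ∷_))
Σₛ-suc {n} f = begin
  sum (map f (map (outside ∷_) ps ++ map (inside ∷_) ps))  ≡⟨ cong sum (map-++ f (map (outside ∷_) ps) _) ⟩
  sum (map f (map (outside ∷_) ps) ++ map f (map (inside ∷_) ps)) ≡⟨ sum-++ (map f (map (outside ∷_) ps)) _ ⟩
  sum (map f (map (outside ∷_) ps)) + sum (map f (map (inside ∷_) ps))  ≡⟨ cong₂ (λ xs ys → sum xs + sum ys) (map-∘ ps) (map-∘ ps) ⟨
  Σₛ (f ∘ (outside ∷_)) + Σₛ (f ∘ (inside ∷_))  ∎
  where
  open ≡-Reasoning
  ps = allSubsets n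

Σₛ-cong : ∀ {f g : Subset n → ℕ} → (∀ p → f p ≡ g p) → Σₛ f ≡ Σₛ g
Σₛ-cong {n} f≗g = cong sum (map-cong f≗g (allSubsets n))

module _ {a} {X : Set a} where

  sum-mono : ∀ {f g : X → ℕ} → (∀ x → f x ≤ g x) → ∀ xs → sum (map f xs) ≤ sum (map g xs)
  sum-mono f≤g []       = z≤n
  sum-mono f≤g (x ∷ xs) = ℕ.+-mono-≤ (f≤g x) (sum-mono f≤g xs)

  sum-0 : ∀ (xs : List X) → sum (map (λ _ → 0) xs) ≡ 0
  sum-0 []       = refl
  sum-0 (_ ∷ xs) = sum-0 xs

  sum-+ : ∀ (f g : X → ℕ) xs → sum (map (λ x → f x + g x) xs) ≡ sum (map f xs) + sum (map g xs)
  sum-+ f g []       = refl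
  sum-+ f g (x ∷ xs) rewrite sum-+ f g xs = lemma (f x) (g x) (sum (map f xs)) (sum (map g xs))
    where
    lemma : ∀ a b c d → a + b + (c + d) ≡ a + c + (b + d)
    lemma = solve-∀

  sum-* : ∀ c (f : X → ℕ) xs → sum (map (λ x → c * f x) xs) ≡ c * sum (map f xs)
  sum-* c f []       = sym (ℕ.*-zeroʳ c)
  sum-* c f (x ∷ xs) rewrite sum-* c f xs = sym (ℕ.*-distribˡ-+ c (f x) _)

Σₛ-none : ∀ {P : Subset n → Set} (P? : ∀ p → Dec (P p)) → (∀ p → ¬ P p) → Σₛ (λ p → 𝟙 (P? p)) ≡ 0
Σₛ-none {n} P? none = trans (Σₛ-cong (λ p → 𝟙-no (P? p) (none p))) (sum-0 (allSubsets n))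

Σᶠ-mono : ∀ {n} {f g : Fin n → ℕ} → (∀ i → f i ≤ g i) → Σᶠ f ≤ Σᶠ g
Σᶠ-mono {zero}  f≤g = z≤n
Σᶠ-mono {suc n} f≤g = ℕ.+-mono-≤ (f≤g zero) (Σᶠ-mono (f≤g ∘ suc))

Σᶠ-∈ : ∀ (p : Subset n) → Σᶠ (λ i → 𝟙 (i ∈? p)) ≡ ∣ p ∣
Σᶠ-∈ []            = refl
Σᶠ-∈ (outside ∷ p) = Σᶠ-∈ p
Σᶠ-∈ (inside ∷ p)  = cong suc (Σᶠ-∈ p)

Σᶠ-sum-comm : ∀ {n a} {X : Set a} (f : Fin n → X → ℕ) xs →
  Σᶠ (λ i → sum (map (f i) xs)) ≡ sum (map (λ x → Σᶠ (λ i → f i x)) xs)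
Σᶠ-sum-comm {zero}  f xs = sym (sum-0 xs)
Σᶠ-sum-comm {suc n} f xs =
  trans (cong (sum (map (f zero) xs) +_) (Σᶠ-sum-comm (f ∘ suc) xs)) (sym (sum-+ (f zero) _ xs))

-- A union bound. Applied to the copies of K_r at a vertex, it bounds `hull` by the number of these
-- copies.
∣⋃filter∣ : ∀ {P : Subset n → Set} (P? : ∀ p → Dec (P p)) {r} → (∀ {p} → P p → ∣ p ∣ ≡ r) →
  ∀ ps → ∣ ⋃ (filter P? ps) ∣ ≤ r * sum (map (λ p → 𝟙 (P? p)) ps)
∣⋃filter∣ {n} P? {r} size []       = ≤-reflexive (trans (∣⊥∣≡0 n) (sym (ℕ.*-zeroʳ r)))
∣⋃filter∣     P? {r} size (p ∷ ps) with P? p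
... | no  _  = ∣⋃filter∣ P? size ps
... | yes Pp = ≤-trans (∣p∪q∣≤∣p∣+∣q∣ p _)
  (≤-trans (ℕ.+-mono-≤ (≤-reflexive (size Pp)) (∣⋃filter∣ P? size ps)) (≤-reflexive (sym (ℕ.*-suc r _))))

-- Counting subsets

nC0≡1 : ∀ n → n C 0 ≡ 1
nC0≡1 n = trans (nCk≡nC[n∸k] {0} {n} z≤n) (nCn≡1 n)

-- The number `k` counts the elements beyond `p`, which makes the count a plain binomial
-- coefficient. `Between q q 0` singles out `q` itself.
Between : Subset n → Subset n → ℕ → Subset n → Set
Between p q k m = ∣ m ∣ ≡ k + ∣ p ∣ × p ⊆ m × m ⊆ q

between? : ∀ (p q : Subset n) k m → Dec (Between p q k m)
between? p q k m = (∣ m ∣ ℕ.≟ k + ∣ p ∣) ×-dec (p ⊆? m) ×-dec (m ⊆? q)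

-- Induction over positions: one that lies in `q` but not in `p` may be taken or left, which is
-- Pascal's rule; at any other position the choice is forced.
count-between : ∀ (p q : Subset n) d k → p ⊆ q → ∣ q ∣ ≡ d + ∣ p ∣ → Σₛ (λ m → 𝟙 (between? p q k m)) ≡ d C k
count-between [] [] zero zero    p⊆q e = trans (ℕ.+-identityʳ _) (𝟙-yes (between? [] [] 0 []) (refl , id , id))
count-between [] [] zero (suc k) p⊆q e = trans (ℕ.+-identityʳ _) (trans (𝟙-no (between? [] [] (suc k) []) λ ()) (sym (k>n⇒nCk≡0 {0} {suc k} (s≤s z≤n))))
count-between (inside ∷ p) (outside ∷ q) d k p⊆q e = contradiction (p⊆q here) λ ()
count-between (outside ∷ p) (outside ∷ q) d k p⊆q e = begin
  Σₛ (λ m → 𝟙 (between? (outside ∷ p) (outside ∷ q) k m))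
    ≡⟨ Σₛ-suc (λ m → 𝟙 (between? (outside ∷ p) (outside ∷ q) k m)) ⟩
  Σₛ (λ m → 𝟙 (between? (outside ∷ p) (outside ∷ q) k (outside ∷ m))) + Σₛ (λ m → 𝟙 (between? (outside ∷ p) (outside ∷ q) k (inside ∷ m)))
    ≡⟨ cong₂ _+_
         (Σₛ-cong λ m → 𝟙-cong (between? (outside ∷ p) (outside ∷ q) k (outside ∷ m)) (between? p q k m)
           (λ (a , b , c) → a , drop-∷-⊆ b , drop-∷-⊆ c)
           (λ (a , b , c) → a , s⊆s b , s⊆s c))
         (Σₛ-none (λ m → between? (outside ∷ p) (outside ∷ q) k (inside ∷ m)) λ m (a , b , c) → contradiction (c here) λ ()) ⟩
  Σₛ (λ m → 𝟙 (between? p q k m)) + 0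
    ≡⟨ ℕ.+-identityʳ _ ⟩
  Σₛ (λ m → 𝟙 (between? p q k m))
    ≡⟨ count-between p q d k (drop-∷-⊆ p⊆q) e ⟩
  d C k ∎
  where open ≡-Reasoning
count-between (inside ∷ p) (inside ∷ q) d k p⊆q e = begin
  Σₛ (λ m → 𝟙 (between? (inside ∷ p) (inside ∷ q) k m))
    ≡⟨ Σₛ-suc (λ m → 𝟙 (between? (inside ∷ p) (inside ∷ q) k m)) ⟩
  Σₛ (λ m → 𝟙 (between? (inside ∷ p) (inside ∷ q) k (outside ∷ m))) + Σₛ (λ m → 𝟙 (between? (inside ∷ p) (inside ∷ q) k (inside ∷ m)))
    ≡⟨ cong₂ _+_
         (Σₛ-none (λ m → between? (inside ∷ p) (inside ∷ q) k (outside ∷ m)) λ m (a , b , c) → contradiction (b here) λ ())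
         (Σₛ-cong λ m → 𝟙-cong (between? (inside ∷ p) (inside ∷ q) k (inside ∷ m)) (between? p q k m)
           (λ (a , b , c) → ℕ.suc-injective (trans a (ℕ.+-suc k _)) , drop-∷-⊆ b , drop-∷-⊆ c)
           (λ (a , b , c) → trans (cong suc a) (sym (ℕ.+-suc k _)) , s⊆s b , s⊆s c)) ⟩
  Σₛ (λ m → 𝟙 (between? p q k m))
    ≡⟨ count-between p q d k (drop-∷-⊆ p⊆q) (ℕ.suc-injective (trans e (ℕ.+-suc d _))) ⟩
  d C k ∎
  where open ≡-Reasoning
count-between (outside ∷ p) (inside ∷ q) zero k p⊆q e =
  contradiction (p⊆q⇒∣p∣≤∣q∣ (drop-∷-⊆ p⊆q)) (ℕ.<⇒≱ (≤-reflexive e))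
count-between (outside ∷ p) (inside ∷ q) (suc d) k p⊆q e = begin
  Σₛ (λ m → 𝟙 (between? (outside ∷ p) (inside ∷ q) k m))
    ≡⟨ Σₛ-suc (λ m → 𝟙 (between? (outside ∷ p) (inside ∷ q) k m)) ⟩
  Σₛ (λ m → 𝟙 (between? (outside ∷ p) (inside ∷ q) k (outside ∷ m))) + Σₛ (λ m → 𝟙 (between? (outside ∷ p) (inside ∷ q) k (inside ∷ m)))
    ≡⟨ cong₂ _+_
         (trans
           (Σₛ-cong λ m → 𝟙-cong (between? (outside ∷ p) (inside ∷ q) k (outside ∷ m)) (between? p q k m)
             (λ (a , b , c) → a , drop-∷-⊆ b , drop-∷-⊆ c)
             (λ (a , b , c) → a , s⊆s b , out⊆ c))
           (count-between p q d k (drop-∷-⊆ p⊆q) (ℕ.suc-injective e)))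
         (withHead k) ⟩
  d C k + rest k
    ≡⟨ pascal k ⟩
  suc d C k ∎
  where
  open ≡-Reasoning
  -- This is `d C (k ∸ 1)`, except that the value at `k = 0` must be 0: no set with 0 further
  -- elements contains the head.
  rest : ℕ → ℕ
  rest zero    = 0
  rest (suc k) = d C k
  pascal : ∀ k → d C k + rest k ≡ suc d C k
  pascal zero    = trans (ℕ.+-identityʳ _) (trans (nC0≡1 d) (sym (nC0≡1 (suc d))))
  pascal (suc k) = trans (ℕ.+-comm (d C suc k) _) (nCk+nC[k+1]≡[n+1]C[k+1] d k)
  withHead : ∀ k → Σₛ (λ m → 𝟙 (between? (outside ∷ p) (inside ∷ q) k (inside ∷ m))) ≡ rest k
  withHead zero = Σₛ-none (λ m → between? (outside ∷ p) (inside ∷ q) 0 (inside ∷ m)) λ m (a , b , c) →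
    contradiction (p⊆q⇒∣p∣≤∣q∣ (drop-∷-⊆ b)) (ℕ.<⇒≱ (≤-reflexive a))
  withHead (suc k) = trans
    (Σₛ-cong λ m → 𝟙-cong (between? (outside ∷ p) (inside ∷ q) (suc k) (inside ∷ m)) (between? p q k m)
      (λ (a , b , c) → ℕ.suc-injective a , drop-∷-⊆ b , drop-∷-⊆ c)
      (λ (a , b , c) → cong suc a , out⊆ b , s⊆s c))
    (count-between p q d k (drop-∷-⊆ p⊆q) (ℕ.suc-injective e))

-- These are the vertex sets of the `k`-cliques in the join with clique part `t`.
Near : Subset n → ℕ → Subset n → Set
Near t k p = ∣ p ∣ ≡ k × ∣ p ∩ ∁ t ∣ ≤ 1

near? : ∀ (t : Subset n) k p → Dec (Near t k p)
near? t k p = (∣ p ∣ ℕ.≟ k) ×-dec (∣ p ∩ ∁ t ∣ ℕ.≤? 1)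

∣p∩∁q∣≡0⇒p⊆q : ∀ (p q : Subset n) → ∣ p ∩ ∁ q ∣ ≤ 0 → p ⊆ q
∣p∩∁q∣≡0⇒p⊆q p q ≤0 {x} x∈p with x ∈? q
... | yes x∈q = x∈q
... | no  x∉q = contradiction
  (≤-trans (≤-reflexive (sym (∣⁅x⁆∣≡1 x))) (≤-trans (p⊆q⇒∣p∣≤∣q∣ λ y∈ → subst (_∈ p ∩ ∁ q) (sym (x∈⁅y⁆⇒x≡y x y∈)) (x∈p∩q⁺ (x∈p , x∉p⇒x∈∁p x∉q))) ≤0)) λ ()

p⊆q⇒∣p∩∁q∣≤0 : ∀ {p q : Subset n} → p ⊆ q → ∣ p ∩ ∁ q ∣ ≤ 0
p⊆q⇒∣p∩∁q∣≤0 {n} {p} {q} p⊆q = ≤-trans (p⊆q⇒∣p∣≤∣q∣ {q = ⊥} λ x∈ →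
  let x∈p , x∈∁q = x∈p∩q⁻ p (∁ q) x∈ in contradiction (p⊆q x∈p) (x∈∁p⇒x∉p x∈∁q)) (≤-reflexive (∣⊥∣≡0 n))

count-⊆ : ∀ (t : Subset n) k → Σₛ (λ p → 𝟙 ((∣ p ∣ ℕ.≟ k) ×-dec (∣ p ∩ ∁ t ∣ ℕ.≤? 0))) ≡ ∣ t ∣ C k
count-⊆ {n} t k = trans
  (Σₛ-cong λ p → 𝟙-cong ((∣ p ∣ ℕ.≟ k) ×-dec (∣ p ∩ ∁ t ∣ ℕ.≤? 0)) (between? ⊥ t k p)
    (λ (a , b) → trans a (sym k+0) , ⊥⊆ , ∣p∩∁q∣≡0⇒p⊆q p t b)
    (λ (a , b , c) → trans a k+0 , p⊆q⇒∣p∩∁q∣≤0 c))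
  (count-between ⊥ t ∣ t ∣ k ⊥⊆ (sym (trans (cong (∣ t ∣ +_) (∣⊥∣≡0 n)) (ℕ.+-identityʳ _))))
  where
  k+0 : k + ∣ ⊥ {n} ∣ ≡ k
  k+0 = trans (cong (k +_) (∣⊥∣≡0 n)) (ℕ.+-identityʳ k)

count-near0 : ∀ (t : Subset n) → Σₛ (λ p → 𝟙 (near? t 0 p)) ≡ 1
count-near0 t = trans
  (Σₛ-cong λ p → 𝟙-cong (near? t 0 p) ((∣ p ∣ ℕ.≟ 0) ×-dec (∣ p ∩ ∁ t ∣ ℕ.≤? 0))
    (λ (a , _) → a , ≤-trans (p⊆q⇒∣p∣≤∣q∣ (p∩q⊆p p (∁ t))) (≤-reflexive a))
    (λ (a , b) → a , ≤-trans b z≤n))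
  (trans (count-⊆ t 0) (nC0≡1 ∣ t ∣))

-- Induction over positions. A chosen position outside `t` forces the other `k` elements into `t`; a
-- position in `t` calls for Pascal's rule in both terms.
count-near : ∀ (t : Subset n) k → Σₛ (λ p → 𝟙 (near? t (suc k) p)) ≡ ∣ ∁ t ∣ * (∣ t ∣ C k) + ∣ t ∣ C suc k
count-near []            k = sym (k>n⇒nCk≡0 {0} {suc k} (s≤s z≤n))
count-near (outside ∷ t) k = begin
  Σₛ (λ p → 𝟙 (near? (outside ∷ t) (suc k) p))
    ≡⟨ Σₛ-suc (λ p → 𝟙 (near? (outside ∷ t) (suc k) p)) ⟩
  Σₛ (λ p → 𝟙 (near? t (suc k) p)) + Σₛ (λ p → 𝟙 (near? (outside ∷ t) (suc k) (inside ∷ p)))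
    ≡⟨ cong₂ _+_ (count-near t k) (trans
      (Σₛ-cong λ p → 𝟙-cong (near? (outside ∷ t) (suc k) (inside ∷ p)) ((∣ p ∣ ℕ.≟ k) ×-dec (∣ p ∩ ∁ t ∣ ℕ.≤? 0))
        (λ (a , b) → ℕ.suc-injective a , ℕ.≤-pred b) (λ (a , b) → cong suc a , s≤s b))
      (count-⊆ t k)) ⟩
  ∣ ∁ t ∣ * (∣ t ∣ C k) + ∣ t ∣ C suc k + ∣ t ∣ C k
    ≡⟨ lemma (∣ ∁ t ∣ * (∣ t ∣ C k)) (∣ t ∣ C suc k) (∣ t ∣ C k) ⟩
  ∣ t ∣ C k + ∣ ∁ t ∣ * (∣ t ∣ C k) + ∣ t ∣ C suc k ∎
  where
  open ≡-Reasoning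
  lemma : ∀ a b c → a + b + c ≡ c + a + b
  lemma = solve-∀
count-near (inside ∷ t) k = begin
  Σₛ (λ p → 𝟙 (near? (inside ∷ t) (suc k) p))
    ≡⟨ Σₛ-suc (λ p → 𝟙 (near? (inside ∷ t) (suc k) p)) ⟩
  Σₛ (λ p → 𝟙 (near? t (suc k) p)) + Σₛ (λ p → 𝟙 (near? t k p))
    ≡⟨ cong (_+ Σₛ (λ p → 𝟙 (near? t k p))) (count-near t k) ⟩
  ∣ ∁ t ∣ * (∣ t ∣ C k) + ∣ t ∣ C suc k + Σₛ (λ p → 𝟙 (near? t k p))
    ≡⟨ step k ⟩
  ∣ ∁ t ∣ * (suc ∣ t ∣ C k) + suc ∣ t ∣ C suc k ∎
  where
  open ≡-Reasoning
  u = ∣ ∁ t ∣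
  a = ∣ t ∣
  lemma : ∀ u x y z → u * y + z + (u * x + y) ≡ u * (x + y) + (y + z)
  lemma = solve-∀
  lemma₀ : ∀ u z → u * 1 + z + 1 ≡ u * 1 + (1 + z)
  lemma₀ = solve-∀
  step : ∀ k → u * (a C k) + a C suc k + Σₛ (λ p → 𝟙 (near? t k p)) ≡ u * (suc a C k) + suc a C suc k
  -- The remaining sum counts sets of size 0, so the induction formula, stated for positive sizes,
  -- is replaced by the count of the empty set.
  step zero rewrite count-near0 t | sym (nCk+nC[k+1]≡[n+1]C[k+1] a 0) | nC0≡1 a | nC0≡1 (suc a) = lemma₀ u (a C 1)
  step (suc k) rewrite count-near t k | sym (nCk+nC[k+1]≡[n+1]C[k+1] a k) | sym (nCk+nC[k+1]≡[n+1]C[k+1] a (suc k)) =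
    lemma u (a C k) (a C suc k) (a C suc (suc k))

-- Cliques

Clique : Adj n → Subset n → Set
Clique A p = ∀ {i j} → i ∈ p → j ∈ p → i ≢ j → A i j ≡ true

-- Deciding through `isCliqueᵇ` makes `does (clique? A p)` compute to `isCliqueᵇ A p`, so that
-- `copiesK r A` unfolds to the sum of `𝟙 (isK? A r p)`.
clique? : ∀ (A : Adj n) p → Dec (Clique A p)
clique? {n} A p = map′ sound complete (T? (isCliqueᵇ A p))
  where
  pair : Fin n → Fin n → Bool
  pair i j = not (lookup p i ∧ lookup p j) ∨ does (i ≟ j) ∨ A i j

  sound : T (isCliqueᵇ A p) → Clique A p
  sound t {i} {j} i∈p j∈p i≢j = go (tabulate⁻ (all⁺ (pair i) (allFin n) (tabulate⁻ (all⁺ _ (allFin n) t) i)) j)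
    where
    go : T (pair i j) → A i j ≡ true
    go t with i ≟ j
    ... | yes i≡j = contradiction i≡j i≢j
    ... | no  _ rewrite []=⇒lookup i∈p | []=⇒lookup j∈p = Equivalence.to T-≡ t

  complete : Clique A p → T (isCliqueᵇ A p)
  complete c = all⁻ _ (tabulate⁺ λ i → all⁻ (pair i) (tabulate⁺ λ j → go i j))
    where
    go : ∀ i j → T (pair i j)
    go i j with lookup p i in eqᵢ | lookup p j in eqⱼ
    ... | false | _     = _
    ... | true  | false = _
    ... | true  | true with i ≟ j
    ...   | yes _   = _
    ...   | no  i≢j = Equivalence.from T-≡ (c (lookup⇒[]= i p eqᵢ) (lookup⇒[]= j p eqⱼ) i≢j)

clique⇒isCliqueᵇ : ∀ (A : Adj n) p → Clique A p → isCliqueᵇ A p ≡ true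
clique⇒isCliqueᵇ A p c = dec-true (clique? A p) c

isCliqueᵇ⇒clique : ∀ (A : Adj n) p → isCliqueᵇ A p ≡ true → Clique A p
isCliqueᵇ⇒clique A p eq = decidable-stable (clique? A p) λ ¬c →
  contradiction (trans (sym eq) (dec-false (clique? A p) ¬c)) λ ()

IsK : Adj n → ℕ → Subset n → Set
IsK A r p = ∣ p ∣ ≡ r × Clique A p

isK? : ∀ (A : Adj n) r p → Dec (IsK A r p)
isK? A r p = (∣ p ∣ ℕ.≟ r) ×-dec clique? A p

Clique-⊆ : ∀ {A : Adj n} → p ⊆ q → Clique A q → Clique A p
Clique-⊆ p⊆q c i∈ j∈ = c (p⊆q i∈) (p⊆q j∈)

addEdge-old : ∀ (A : Adj n) {u v i j} → A i j ≡ true → addEdge A u v i j ≡ true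
addEdge-old A eq rewrite eq = refl

addEdge-new : ∀ (A : Adj n) u v → addEdge A u v u v ≡ true
addEdge-new A u v rewrite dec-true (u ≟ u) refl | dec-true (v ≟ v) refl = ∨-zeroʳ (A u v)

addEdge-new′ : ∀ (A : Adj n) u v → addEdge A u v v u ≡ true
addEdge-new′ A u v rewrite dec-true (u ≟ u) refl | dec-true (v ≟ v) refl
  | ∨-zeroʳ (does (v ≟ u) ∧ does (u ≟ v)) = ∨-zeroʳ (A v u)

addEdge⁻ : ∀ (A : Adj n) {u v i j} → addEdge A u v i j ≡ true →
  A i j ≡ true ⊎ (i ≡ u × j ≡ v) ⊎ (i ≡ v × j ≡ u)
addEdge⁻ A {u} {v} {i} {j} e with A i j
... | true  = inj₁ refl
... | false with i ≟ u | j ≟ v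
...   | yes a | yes b = inj₂ (inj₁ (a , b))
...   | no _  | _ with i ≟ v | j ≟ u
...     | yes a | yes b = inj₂ (inj₂ (a , b))
addEdge⁻ A {u} {v} {i} {j} e | false | yes _ | no _ with i ≟ v | j ≟ u
...     | yes a | yes b = inj₂ (inj₂ (a , b))

-- K_{|t|} * \bar K_{n-|t|} with clique part t.
IsJoin : Adj n → Subset n → Set
IsJoin A t = ∀ i j → A i j ≡ not (does (i ≟ j)) ∧ (lookup t i ∨ lookup t j)

∉⇒lookup : x ∉ p → lookup p x ≡ false
∉⇒lookup {x = x} {p} x∉p with lookup p x in eq
... | false = refl
... | true  = contradiction (lookup⇒[]= x p eq) x∉p

-- Copies of K_r and saturation in the join of a clique and an independent set.

module Join {A : Adj n} (t : Subset n) (J : IsJoin A t) where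

  edge : ∀ {i j} → i ≢ j → i ∈ t ⊎ j ∈ t → A i j ≡ true
  edge {i} {j} i≢j i∨j rewrite J i j | dec-false (i ≟ j) i≢j with i∨j
  ... | inj₁ i∈t rewrite []=⇒lookup i∈t = refl
  ... | inj₂ j∈t rewrite []=⇒lookup j∈t = ∨-zeroʳ (lookup t i)

  nonedge : ∀ {i j} → i ∉ t → j ∉ t → A i j ≡ false
  nonedge {i} {j} i∉t j∉t rewrite J i j | ∉⇒lookup i∉t | ∉⇒lookup j∉t with does (i ≟ j)
  ... | true  = refl
  ... | false = refl

  clique⇒∣p∩∁t∣≤1 : Clique A p → ∣ p ∩ ∁ t ∣ ≤ 1
  clique⇒∣p∩∁t∣≤1 {p} c = x≡y⇒∣p∣≤1 uniq
    where
    uniq : ∀ {x y} → x ∈ p ∩ ∁ t → y ∈ p ∩ ∁ t → x ≡ y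
    uniq {x} {y} x∈ y∈ with x ≟ y
    ... | yes x≡y = x≡y
    ... | no  x≢y =
      let x∈p , x∈∁t = x∈p∩q⁻ p (∁ t) x∈
          y∈p , y∈∁t = x∈p∩q⁻ p (∁ t) y∈
      in contradiction (trans (sym (c x∈p y∈p x≢y)) (nonedge (x∈∁p⇒x∉p x∈∁t) (x∈∁p⇒x∉p y∈∁t))) λ ()

  ∣p∩∁t∣≤1⇒clique : ∣ p ∩ ∁ t ∣ ≤ 1 → Clique A p
  ∣p∩∁t∣≤1⇒clique {p} ≤1 {i} {j} i∈p j∈p i≢j with i ∈? t | j ∈? t
  ... | yes i∈t | _       = edge i≢j (inj₁ i∈t)
  ... | no _    | yes j∈t = edge i≢j (inj₂ j∈t)
  ... | no i∉t  | no j∉t  = contradiction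
    (∣p∣≤1⇒x≡y ≤1 (x∈p∩q⁺ (i∈p , x∉p⇒x∈∁p i∉t)) (x∈p∩q⁺ (j∈p , x∉p⇒x∈∁p j∉t))) i≢j

  copies : ∀ k → copiesK (suc k) A ≡ (n ∸ ∣ t ∣) * (∣ t ∣ C k) + ∣ t ∣ C suc k
  copies k = begin
    Σₛ (λ p → 𝟙 (isK? A (suc k) p))
      ≡⟨ Σₛ-cong (λ p → 𝟙-cong (isK? A (suc k) p) (near? t (suc k) p)
           (λ (a , c) → a , clique⇒∣p∩∁t∣≤1 c) (λ (a , b) → a , ∣p∩∁t∣≤1⇒clique b)) ⟩
    Σₛ (λ p → 𝟙 (near? t (suc k) p))
      ≡⟨ count-near t k ⟩
    ∣ ∁ t ∣ * (∣ t ∣ C k) + ∣ t ∣ C suc k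
      ≡⟨ cong (λ m → m * (∣ t ∣ C k) + ∣ t ∣ C suc k) (∣∁p∣≡n∸∣p∣ t) ⟩
    (n ∸ ∣ t ∣) * (∣ t ∣ C k) + ∣ t ∣ C suc k ∎
    where open ≡-Reasoning

  -- A clique has at most one vertex outside `t`, hence at most `1 + ∣ t ∣` vertices. Two
  -- non-adjacent vertices both lie outside `t`, and their new edge completes a clique with `t`.
  saturated : Saturated (2 + ∣ t ∣) A
  saturated = record { symmetric = symm ; irreflexive = irr } , free , extend
    where
    symm : ∀ i j → A i j ≡ A j i
    symm i j rewrite J i j | J j i | ∨-comm (lookup t i) (lookup t j)
      | does-⇔ (mk⇔ sym sym) (i ≟ j) (j ≟ i) = refl
    irr : ∀ i → A i i ≡ false
    irr i rewrite J i i | dec-true (i ≟ i) refl = refl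
    free : ¬ ContainsK (2 + ∣ t ∣) A
    free (p , ∣p∣ , c) = ℕ.<⇒≱ (≤-reflexive (sym ∣p∣)) (≤-trans (∣p∣≤∣q∣+∣p∩∁q∣ p t)
      (≤-trans (ℕ.+-monoʳ-≤ ∣ t ∣ (clique⇒∣p∩∁t∣≤1 (isCliqueᵇ⇒clique A p c))) (≤-reflexive (ℕ.+-comm ∣ t ∣ 1))))
    extend : ∀ u v → u ≢ v → A u v ≡ false → ContainsK (2 + ∣ t ∣) (addEdge A u v)
    extend u v u≢v uv = K , ∣K∣ , clique⇒isCliqueᵇ (addEdge A u v) K cl
      where
      out : ∀ {w z} → w ≢ z → A w z ≡ false → w ∉ t
      out w≢z wz w∈t = contradiction (trans (sym (edge w≢z (inj₁ w∈t))) wz) λ ()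
      u∉t : u ∉ t
      u∉t = out u≢v uv
      v∉t : v ∉ t
      v∉t = out (u≢v ∘ sym) (trans (symm v u) uv)
      K = ⁅ u ⁆ ∪ (⁅ v ⁆ ∪ t)
      ∣K∣ : ∣ K ∣ ≡ 2 + ∣ t ∣
      ∣K∣ = trans (x∉p⇒∣⁅x⁆∪p∣≡1+∣p∣ u∉) (cong suc (x∉p⇒∣⁅x⁆∪p∣≡1+∣p∣ v∉t))
        where
        u∉ : u ∉ ⁅ v ⁆ ∪ t
        u∉ u∈ with y∈⁅x⁆∪p⁻ v t u∈
        ... | inj₁ u≡v = u≢v u≡v
        ... | inj₂ u∈t = u∉t u∈t
      member : ∀ {i} → i ∈ K → i ≡ u ⊎ i ≡ v ⊎ i ∈ t
      member i∈ with y∈⁅x⁆∪p⁻ u _ i∈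
      ... | inj₁ e = inj₁ e
      ... | inj₂ r = inj₂ (y∈⁅x⁆∪p⁻ v t r)
      cl : Clique (addEdge A u v) K
      cl {i} {j} i∈ j∈ i≢j with i ∈? t | j ∈? t
      ... | yes i∈t | _       = addEdge-old A (edge i≢j (inj₁ i∈t))
      ... | no _    | yes j∈t = addEdge-old A (edge i≢j (inj₂ j∈t))
      ... | no i∉t  | no j∉t with member i∈ | member j∈
      ...   | inj₂ (inj₂ i∈t)  | _                = contradiction i∈t i∉t
      ...   | _                | inj₂ (inj₂ j∈t)  = contradiction j∈t j∉t
      ...   | inj₁ refl        | inj₁ refl        = contradiction refl i≢j
      ...   | inj₂ (inj₁ refl) | inj₂ (inj₁ refl) = contradiction refl i≢j
      ...   | inj₁ refl        | inj₂ (inj₁ refl) = addEdge-new A u v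
      ...   | inj₂ (inj₁ refl) | inj₁ refl        = addEdge-new′ A u v

-- Relabelling a join so that its clique part comes first.

toℕ-punchIn-fromℕ : ∀ (i : Fin n) → toℕ (punchIn (fromℕ n) i) ≡ toℕ i
toℕ-punchIn-fromℕ zero    = refl
toℕ-punchIn-fromℕ (suc i) = cong suc (toℕ-punchIn-fromℕ i)

≤⇒<ᵇ≡false : ∀ {m n} → n ≤ m → (m <ᵇ n) ≡ false
≤⇒<ᵇ≡false {m} {n} n≤m = dec-false (m ℕ.<? n) (ℕ.≤⇒≯ n≤m)

-- A head in `t` stays in front and shifts the tail by one. A head outside `t` goes to the last
-- position, which leaves the positions given to the tail as they are.
gather : ∀ (t : Subset n) → Permutation′ n
gather []                = idₚ
gather (inside ∷ t)      = lift₀ (gather t)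
gather {suc n} (outside ∷ t) = insert zero (fromℕ n) (gather t)

gather-front : ∀ (t : Subset n) i → (toℕ (gather t ⟨$⟩ʳ i) <ᵇ ∣ t ∣) ≡ lookup t i
gather-front (inside ∷ t)  zero    = refl
gather-front (inside ∷ t)  (suc i) = gather-front t i
gather-front {suc n} (outside ∷ t) zero    rewrite toℕ-fromℕ n = ≤⇒<ᵇ≡false (∣p∣≤n t)
gather-front (outside ∷ t) (suc i) rewrite toℕ-punchIn-fromℕ (gather t ⟨$⟩ʳ i) = gather-front t i

join-isomorphic : ∀ {A : Adj n} t → IsJoin A t → Isomorphic A (joinCliqueIndep n ∣ t ∣)
join-isomorphic {A = A} t J = f , (π ⟨$⟩ˡ_) , (λ _ → inverseˡ π) , (λ _ → inverseʳ π) , eq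
  where
  π = gather t
  f = π ⟨$⟩ʳ_
  eq : ∀ i j → A i j ≡ joinCliqueIndep _ ∣ t ∣ (f i) (f j)
  eq i j rewrite J i j | gather-front t i | gather-front t j
    | does-⇔ (mk⇔ (cong f) (λ e → trans (sym (inverseˡ π)) (trans (cong (π ⟨$⟩ˡ_) e) (inverseˡ π)))) (i ≟ j) (f i ≟ f j) = refl

initial : ∀ n → ℕ → Subset n
initial n k = tabulate (λ i → toℕ i <ᵇ k)

∣initial∣ : ∀ {n k} → k ≤ n → ∣ initial n k ∣ ≡ k
∣initial∣ {zero}  {zero}  z≤n       = refl
∣initial∣ {suc n} {zero}  z≤n       = ∣initial∣ {n} z≤n
∣initial∣ {suc n} {suc k} (s≤s k≤n) = cong suc (∣initial∣ k≤n)

joinCliqueIndep-isJoin : ∀ n k → IsJoin (joinCliqueIndep n k) (initial n k)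
joinCliqueIndep-isJoin n k i j
  rewrite lookup∘tabulate (λ i → toℕ i <ᵇ k) i | lookup∘tabulate (λ i → toℕ i <ᵇ k) j = refl

true≢false : ∀ {b : Bool} → b ≡ true → b ≡ false → ∀ {ℓ} {X : Set ℓ} → X
true≢false refl ()

-- Later `X` is the extremal structure: either some vertex reveals it, or all vertices satisfy the
-- weight bound.
all⊎ : ∀ {n} {X : Set} {Y : Fin n → Set} → (∀ i → X ⊎ Y i) → X ⊎ (∀ i → Y i)
all⊎ {zero}  f = inj₂ λ ()
all⊎ {suc n} f with f zero | all⊎ (f ∘ suc)
... | inj₁ x | _       = inj₁ x
... | inj₂ _ | inj₁ x  = inj₁ x
... | inj₂ y | inj₂ ys = inj₂ λ { zero → y ; (suc i) → ys i }

-- Local structure of saturated graphs.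

module Saturation {n t} {A : Adj n} (sat : Saturated (2 + t) A) where

  symA : ∀ {i j} {b} → A i j ≡ b → A j i ≡ b
  symA {i} {j} = trans (IsSimple.symmetric (proj₁ sat) j i)

  _∼_ : Fin n → Subset n → Set
  x ∼ p = ∀ {y} → y ∈ p → A x y ≡ true

  ∼⇒∉ : x ∼ p → x ∉ p
  ∼⇒∉ {x} x∼p x∈p = true≢false (x∼p x∈p) (IsSimple.irreflexive (proj₁ sat) x)

  ∣⁅x⁆∪p∣ : x ∼ p → ∣ ⁅ x ⁆ ∪ p ∣ ≡ suc ∣ p ∣
  ∣⁅x⁆∪p∣ {x} {p} x∼p = x∉p⇒∣⁅x⁆∪p∣≡1+∣p∣ (∼⇒∉ {x} {p} x∼p)

  ∼-∪ : ∀ {x y p} → A x y ≡ true → x ∼ p → x ∼ (⁅ y ⁆ ∪ p)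
  ∼-∪ {y = y} {p} xy x∼p z∈ with y∈⁅x⁆∪p⁻ y p z∈
  ... | inj₁ refl = xy
  ... | inj₂ z∈p  = x∼p z∈p

  Clique-∪ : ∀ {x p} → x ∼ p → Clique A p → Clique A (⁅ x ⁆ ∪ p)
  Clique-∪ {x} {p} x∼p c i∈ j∈ i≢j with y∈⁅x⁆∪p⁻ x p i∈ | y∈⁅x⁆∪p⁻ x p j∈
  ... | inj₁ refl | inj₁ refl = contradiction refl i≢j
  ... | inj₁ refl | inj₂ j∈p  = x∼p j∈p
  ... | inj₂ i∈p  | inj₁ refl = symA (x∼p i∈p)
  ... | inj₂ i∈p  | inj₂ j∈p  = c i∈p j∈p i≢j

  clique-size : ∀ {p} → Clique A p → ¬ (2 + t ≤ ∣ p ∣)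
  clique-size {p} c big =
    let m , _ , m⊆p , ∣m∣ = subsetBetween ⊥ p (2 + t) ⊥⊆ (≤-trans (≤-reflexive (∣⊥∣≡0 n)) z≤n) big
    in proj₁ (proj₂ sat) (m , ∣m∣ , clique⇒isCliqueᵇ A m (Clique-⊆ m⊆p c))

  -- The K_{t+2} created by the edge `uv` contains both `u` and `v`, since it would otherwise be a
  -- clique of `A`. Every other pair in it is an old edge, and at least `t` vertices remain without
  -- `u` and `v`.
  commonClique : ∀ {u v} → u ≢ v → A u v ≡ false →
    ∃ λ s → ∣ s ∣ ≡ t × Clique A s × u ∼ s × v ∼ s
  commonClique {u} {v} u≢v uv
    with p , ∣p∣ , c′ ← proj₂ (proj₂ sat) u v u≢v uv = fromK (isCliqueᵇ⇒clique (addEdge A u v) p c′)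
    where
    fromK : Clique (addEdge A u v) p → ∃ λ s → ∣ s ∣ ≡ t × Clique A s × u ∼ s × v ∼ s
    fromK c =
      let s , _ , s⊆ , ∣s∣ = subsetBetween ⊥ rest t ⊥⊆ (≤-trans (≤-reflexive (∣⊥∣≡0 n)) z≤n) t≤∣rest∣
      in s , ∣s∣ , (λ i∈ j∈ i≢j → old (rest-p (s⊆ i∈)) (rest-p (s⊆ j∈)) i≢j (rest-u (s⊆ i∈)) (rest-v (s⊆ i∈)))
           , (λ y∈ → symA (old (rest-p (s⊆ y∈)) u∈p (rest-u (s⊆ y∈)) (rest-u (s⊆ y∈)) (rest-v (s⊆ y∈))))
           , (λ y∈ → symA (old (rest-p (s⊆ y∈)) v∈p (rest-v (s⊆ y∈)) (rest-u (s⊆ y∈)) (rest-v (s⊆ y∈))))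
      where
      old : ∀ {i j} → i ∈ p → j ∈ p → i ≢ j → i ≢ u → i ≢ v → A i j ≡ true
      old i∈ j∈ i≢j i≢u i≢v with addEdge⁻ A (c i∈ j∈ i≢j)
      ... | inj₁ e = e
      ... | inj₂ (inj₁ (e , _)) = contradiction e i≢u
      ... | inj₂ (inj₂ (e , _)) = contradiction e i≢v

      oldClique : (∀ {i j} → i ∈ p → j ∈ p → ¬ (i ≡ u × j ≡ v)) → Clique A p
      oldClique new i∈ j∈ i≢j with addEdge⁻ A (c i∈ j∈ i≢j)
      ... | inj₁ e = e
      ... | inj₂ (inj₁ e) = contradiction e (new i∈ j∈)
      ... | inj₂ (inj₂ (a , b)) = contradiction (b , a) (new j∈ i∈)

      notOld : ¬ Clique A p
      notOld c = clique-size c (≤-reflexive (sym ∣p∣))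

      u∈p : u ∈ p
      u∈p with u ∈? p
      ... | yes u∈ = u∈
      ... | no  u∉ = ⊥-elim (notOld (oldClique λ { i∈ _ (refl , _) → u∉ i∈ }))

      v∈p : v ∈ p
      v∈p with v ∈? p
      ... | yes v∈ = v∈
      ... | no  v∉ = ⊥-elim (notOld (oldClique λ { _ j∈ (_ , refl) → v∉ j∈ }))

      rest : Subset n
      rest = p ∩ ∁ (⁅ u ⁆ ∪ ⁅ v ⁆)

      rest-p : ∀ {i} → i ∈ rest → i ∈ p
      rest-p = p∩q⊆p p _

      rest-u : ∀ {i} → i ∈ rest → i ≢ u
      rest-u i∈ refl = x∈∁p⇒x∉p (p∩q⊆q p _ i∈) (x∈⁅x⁆∪p u ⁅ v ⁆)

      rest-v : ∀ {i} → i ∈ rest → i ≢ v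
      rest-v i∈ refl = x∈∁p⇒x∉p (p∩q⊆q p _ i∈) (x∈p∪q⁺ (inj₂ (x∈⁅x⁆ v)))

      t≤∣rest∣ : t ≤ ∣ rest ∣
      t≤∣rest∣ = ℕ.+-cancelˡ-≤ 2 t ∣ rest ∣ (≤-trans (≤-reflexive (sym ∣p∣))
        (≤-trans (∣p∣≤∣q∣+∣p∩∁q∣ p (⁅ u ⁆ ∪ ⁅ v ⁆))
          (ℕ.+-monoˡ-≤ ∣ rest ∣ (≤-trans (∣⁅x⁆∪p∣≤1+∣p∣ u ⁅ v ⁆) (s≤s (≤-reflexive (∣⁅x⁆∣≡1 v)))))))

  module _ {k} (1≤k : 1 ≤ k) (k≤t : k ≤ t) where

    r : ℕ
    r = suc k

    -- The set `{x, y}` grows inside `p` to size `r`; it fits because `1 ≤ k` gives `r ≥ 2`.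
    cliqueThrough : ∀ {p x y} → Clique A p → r ≤ ∣ p ∣ → x ∈ p → y ∈ p →
      ∃ λ q → IsK A r q × x ∈ q × y ∈ q
    cliqueThrough {p} {x} {y} c r≤ x∈p y∈p =
      let q , xy⊆q , q⊆p , ∣q∣ = subsetBetween (⁅ x ⁆ ∪ ⁅ y ⁆) p r sub
            (≤-trans (∣⁅x⁆∪p∣≤1+∣p∣ x ⁅ y ⁆) (s≤s (≤-trans (≤-reflexive (∣⁅x⁆∣≡1 y)) 1≤k))) r≤
      in q , (∣q∣ , Clique-⊆ q⊆p c) , xy⊆q (x∈⁅x⁆∪p x ⁅ y ⁆) , xy⊆q (x∈p∪q⁺ (inj₂ (x∈⁅x⁆ y)))
      where
      sub : ⁅ x ⁆ ∪ ⁅ y ⁆ ⊆ p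
      sub z∈ with y∈⁅x⁆∪p⁻ x ⁅ y ⁆ z∈
      ... | inj₁ refl = x∈p
      ... | inj₂ z∈⁅y⁆ with refl ← x∈⁅y⁆⇒x≡y y z∈⁅y⁆ = y∈p

    -- A vertex whose r-cliques all lie in one (t+1)-clique determines the graph.
    module _ {w T} (∣T∣ : ∣ T ∣ ≡ t) (cT : Clique A T) (w∼T : w ∼ T)
             (only : ∀ {q} → IsK A r q → w ∈ q → q ⊆ ⁅ w ⁆ ∪ T) where

      cliqueAtw⊆T : ∀ {p x} → Clique A p → r ≤ ∣ p ∣ → w ∈ p → x ∈ p → x ≢ w → x ∈ T
      cliqueAtw⊆T c r≤ w∈p x∈p x≢w with cliqueThrough c r≤ w∈p x∈p
      ... | q , K , w∈q , x∈q with y∈⁅x⁆∪p⁻ w T (only K w∈q x∈q)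
      ...   | inj₁ x≡w = contradiction x≡w x≢w
      ...   | inj₂ x∈T = x∈T

      -- With `w`, the common clique `s` has `t + 1 ≥ r` vertices, so each vertex of `s` shares an
      -- `r`-clique with `w` and lies in `T`. Equal sizes give `s = T`.
      nonneighbour : ∀ {x} → x ≢ w → A x w ≡ false → x ∼ T
      nonneighbour {x} x≢w xw = x∼T (commonClique x≢w xw)
        where
        x∼T : (∃ λ s → ∣ s ∣ ≡ t × Clique A s × x ∼ s × w ∼ s) → x ∼ T
        x∼T (s , ∣s∣ , cs , x∼s , w∼s) y∈T = x∼s (⊆∧∣∣≥⇒⊇ s⊆T (≤-reflexive (trans ∣T∣ (sym ∣s∣))) y∈T)
          where
          s⊆T : s ⊆ T
          s⊆T {z} z∈s = cliqueAtw⊆T (Clique-∪ w∼s cs)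
            (≤-trans (s≤s (≤-trans k≤t (≤-reflexive (sym ∣s∣)))) (≤-reflexive (sym (∣⁅x⁆∪p∣ {w} {s} w∼s))))
            (x∈⁅x⁆∪p w s) (x∈p∪q⁺ (inj₂ z∈s)) λ { refl → ∼⇒∉ {w} {s} w∼s z∈s }

      -- Otherwise T together with x and y would be a clique on t + 2 vertices.
      nonadjacent : ∀ {x y} → x ∼ T → y ∼ T → A x y ≡ false
      nonadjacent {x} {y} x∼T y∼T with A x y in xy
      ... | false = refl
      ... | true  = contradiction (≤-reflexive (sym (trans (∣⁅x⁆∪p∣ {x} {⁅ y ⁆ ∪ T} x∼) (cong suc (trans (∣⁅x⁆∪p∣ {y} {T} y∼T) (cong suc ∣T∣))))))
        (clique-size (Clique-∪ x∼ (Clique-∪ y∼T cT)))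
        where
        x∼ : x ∼ (⁅ y ⁆ ∪ T)
        x∼ = ∼-∪ {x} {y} {T} xy x∼T

      -- At most one vertex of the common clique s of x and y misses w, and the
      -- other vertices form with x and w a clique on at least t + 1 vertices.
      neighbour : ∀ {x} → x ∉ T → A x w ≡ true → x ∼ T
      neighbour {x} x∉T xw {y} y∈T with A x y in xy
      ... | true  = refl
      ... | false with commonClique {x} {y} (λ { refl → x∉T y∈T }) xy
      ...   | s , ∣s∣ , cs , x∼s , y∼s = ⊥-elim (x∉T x∈T)
        where
        x≢w : x ≢ w
        x≢w refl = ∼⇒∉ {w} {⁅ w ⁆} (λ z∈ → subst (λ z → A w z ≡ true) (sym (x∈⁅y⁆⇒x≡y w z∈)) xw) (x∈⁅x⁆ w)
        large : ∀ {s′} → s′ ⊆ s → w ∼ s′ → t ≤ suc ∣ s′ ∣ → x ∈ T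
        large {s′} s′⊆s w∼s′ t≤ = cliqueAtw⊆T
          (Clique-∪ {w} w∼ (Clique-∪ {x} {s′} x∼s′ (Clique-⊆ s′⊆s cs)))
          (≤-trans (s≤s (≤-trans k≤t t≤)) (≤-reflexive (sym (trans (∣⁅x⁆∪p∣ {w} {⁅ x ⁆ ∪ s′} w∼) (cong suc (∣⁅x⁆∪p∣ {x} {s′} x∼s′))))))
          (x∈⁅x⁆∪p w _) (x∈p∪q⁺ (inj₂ (x∈⁅x⁆∪p x s′))) x≢w
          where
          x∼s′ : x ∼ s′
          x∼s′ z∈ = x∼s (s′⊆s z∈)
          w∼ : w ∼ (⁅ x ⁆ ∪ s′)
          w∼ = ∼-∪ {w} {x} {s′} (symA xw) w∼s′
        x∈T : x ∈ T
        x∈T with w ∈? s | any? (λ o → (o ∈? s) ×-dec (A o w ≟ᴮ false))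
        -- If `w` itself lies in `s`, then `s` with `x` is already a large clique through `w`.
        ... | yes w∈s | _ = cliqueAtw⊆T (Clique-∪ {x} {s} x∼s cs)
          (≤-trans (s≤s (≤-trans k≤t (≤-reflexive (sym ∣s∣)))) (≤-reflexive (sym (∣⁅x⁆∪p∣ {x} {s} x∼s))))
          (x∈p∪q⁺ (inj₂ w∈s)) (x∈⁅x⁆∪p x s) x≢w
        ... | no _ | no none = large {s} id w∼s (≤-trans (≤-reflexive (sym ∣s∣)) (ℕ.n≤1+n _))
          where
          w∼s : w ∼ s
          w∼s {z} z∈ with A w z in wz
          ... | true  = refl
          ... | false = contradiction (z , z∈ , symA wz) none
        ... | no w∉s | yes (o , o∈s , ow) = large {s ∩ ∁ ⁅ o ⁆} (p∩q⊆p s _) w∼s′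
          (≤-trans (≤-reflexive (sym ∣s∣)) (≤-trans (∣p∣≤∣q∣+∣p∩∁q∣ s ⁅ o ⁆) (ℕ.+-monoˡ-≤ _ (≤-reflexive (∣⁅x⁆∣≡1 o)))))
          where
          missesw : ∀ {z} → z ∈ s → A z w ≡ false → z ∼ T
          missesw z∈s zw = nonneighbour (λ { refl → w∉s z∈s }) zw
          w∼s′ : w ∼ (s ∩ ∁ ⁅ o ⁆)
          w∼s′ {z} z∈ with A w z in wz
          ... | true  = refl
          -- A second vertex of `s` missing `w` would, like `o`, be joined to all of `T`; the two
          -- would then be non-adjacent, although both lie in the clique `s`.
          ... | false =
            let z∈s , z∈∁o = x∈p∩q⁻ s (∁ ⁅ o ⁆) z∈
            in true≢false (cs z∈s o∈s (x∉⁅y⁆⇒x≢y (x∈∁p⇒x∉p z∈∁o)))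
                 (nonadjacent (missesw z∈s (symA wz)) (missesw o∈s ow))

      outside∼T : ∀ {x} → x ∉ T → x ∼ T
      outside∼T {x} x∉T with x ≟ w
      ... | yes refl = w∼T
      ... | no  x≢w with A x w in xw
      ...   | true  = neighbour x∉T xw
      ...   | false = nonneighbour x≢w xw

      isJoin : IsJoin A T
      isJoin i j with i ≟ j
      ... | yes refl = IsSimple.irreflexive (proj₁ sat) i
      ... | no  i≢j with i ∈? T | j ∈? T
      ...   | yes i∈T | yes j∈T rewrite []=⇒lookup i∈T = cT i∈T j∈T i≢j
      ...   | yes i∈T | no  j∉T rewrite []=⇒lookup i∈T = symA (outside∼T j∉T i∈T)
      ...   | no  i∉T | yes j∈T rewrite ∉⇒lookup i∉T | []=⇒lookup j∈T = outside∼T i∉T j∈T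
      ...   | no  i∉T | no  j∉T rewrite ∉⇒lookup i∉T | ∉⇒lookup j∉T = nonadjacent (outside∼T i∉T) (outside∼T j∉T)

    -- Greedy choice of a bounded absorbing set.

    Kat? : ∀ w p → Dec (IsK A r p × w ∈ p)
    Kat? w p = isK? A r p ×-dec (w ∈? p)

    degK : Fin n → ℕ
    degK w = Σₛ (λ p → 𝟙 (Kat? w p))

    -- The vertex `w` is added separately because it may lie in no copy of K_r.
    hull : Fin n → Subset n
    hull w = ⁅ w ⁆ ∪ ⋃ (filter (Kat? w) (allSubsets n))

    ∣hull∣ : ∀ w → ∣ hull w ∣ ≤ suc (r * degK w)
    ∣hull∣ w = ≤-trans (∣⁅x⁆∪p∣≤1+∣p∣ w _) (s≤s (∣⋃filter∣ (Kat? w) (proj₁ ∘ proj₁) (allSubsets n)))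

    hull-upper : ∀ {w q} → IsK A r q → w ∈ q → q ⊆ hull w
    hull-upper {w} K w∈q x∈q = x∈p∪q⁺ (inj₂ (⋃-upper (∈-filter⁺ (Kat? w) (∈-allSubsets _) (K , w∈q)) x∈q))

    -- The invariant of the greedy choice: `P` holds the chosen vertices, `M` all that they reach
    -- through copies of K_r.
    Absorbs : Subset n → Subset n → Set
    Absorbs M P = P ⊆ M × (∀ {v q} → v ∈ P → IsK A r q → v ∈ q → q ⊆ M)

    -- The clique `s` supplies `t C k` copies of K_r whose only vertex outside `M` is `w`.
    Covers : ℕ → Subset n → Set
    Covers d M = ∀ w → w ∉ M → degK w ≤ d → ∃ λ s → ∣ s ∣ ≡ t × Clique A s × w ∼ s × s ⊆ M

    -- Such a `w` misses some `v` in `P`. The common clique of `v` and `w` lies in `M`, because each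
    -- of its vertices shares an `r`-clique with `v`.
    absorbs⇒covers : ∀ {d M P} → Absorbs M P →
      (∀ w → w ∉ M → degK w ≤ d → ¬ (w ∼ P)) → Covers d M
    absorbs⇒covers {d} {M} {P} (P⊆M , absorb) stop w w∉M small
      with any? (λ v → (v ∈? P) ×-dec (A w v ≟ᴮ false))
    ... | no none = ⊥-elim (stop w w∉M small w∼P)
      where
      w∼P : w ∼ P
      w∼P {v} v∈P with A w v in wv
      ... | true  = refl
      ... | false = contradiction (v , v∈P , wv) none
    ... | yes (v , v∈P , wv) with commonClique {w} {v} (λ { refl → w∉M (P⊆M v∈P) }) wv
    ...   | s , ∣s∣ , cs , w∼s , v∼s = s , ∣s∣ , cs , w∼s , s⊆M
      where
      s⊆M : s ⊆ M
      s⊆M x∈s =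
        let q , K , v∈q , x∈q = cliqueThrough (Clique-∪ {v} {s} v∼s cs)
              (≤-trans (s≤s (≤-trans k≤t (≤-reflexive (sym ∣s∣)))) (≤-reflexive (sym (∣⁅x⁆∪p∣ {v} {s} v∼s))))
              (x∈⁅x⁆∪p v s) (x∈p∪q⁺ (inj₂ x∈s))
        in absorb v∈P K v∈q x∈q

    -- P cannot outgrow r vertices, since M contains every r-clique meeting P.
    greedy : ∀ d f P M → Clique A P → ∣ P ∣ + f ≡ r → Absorbs M P →
      ∣ M ∣ ≤ ∣ P ∣ * suc (r * d) → ∃ λ M′ → ∣ M′ ∣ ≤ r * suc (r * d) × Covers d M′
    -- The number `f` says how many vertices `P` lacks to have `r`. At zero, any `w` joined to `P`
    -- would share an `r`-clique with a vertex of `P` and thus lie in `M`.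
    greedy d zero P M cP ∣P∣ abs ∣M∣ =
      M , ≤-trans ∣M∣ (≤-reflexive (cong (_* suc (r * d)) ∣P∣≡r)) , absorbs⇒covers {d} {M} {P} abs stop
      where
      ∣P∣≡r : ∣ P ∣ ≡ r
      ∣P∣≡r = trans (sym (ℕ.+-identityʳ _)) ∣P∣
      stop : ∀ w → w ∉ M → degK w ≤ d → ¬ (w ∼ P)
      stop w w∉M _ w∼P with nonempty? P
      ... | no empty = contradiction (trans (sym ∣P∣≡r) (trans (cong ∣_∣ (Empty-unique empty)) (∣⊥∣≡0 n))) λ ()
      ... | yes (v , v∈P) =
        let q , K , v∈q , w∈q = cliqueThrough (Clique-∪ {w} {P} w∼P cP)
              (≤-trans (≤-reflexive (sym ∣P∣≡r)) (∣q∣≤∣p∪q∣ ⁅ w ⁆ P))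
              (x∈p∪q⁺ (inj₂ v∈P)) (x∈⁅x⁆∪p w P)
        in w∉M (proj₂ abs v∈P K v∈q w∈q)
    greedy d (suc f) P M cP ∣P∣ abs ∣M∣
      with any? (λ w → ¬? (w ∈? M) ×-dec (degK w ℕ.≤? d) ×-dec Lift? (λ v → A w v ≟ᴮ true) P)
    ... | no none = M
      , ≤-trans ∣M∣ (ℕ.*-monoˡ-≤ (suc (r * d)) (≤-trans (ℕ.m≤m+n _ (suc f)) (≤-reflexive ∣P∣)))
      , absorbs⇒covers {d} {M} {P} abs λ w w∉M small w∼P → none (w , w∉M , small , w∼P)
    ... | yes (w , w∉M , small , w∼P) =
      greedy d f (⁅ w ⁆ ∪ P) (hull w ∪ M) (Clique-∪ {w} {P} w∼P cP)
        (trans (cong (_+ f) ∣wP∣) (trans (sym (ℕ.+-suc ∣ P ∣ f)) ∣P∣)) (P⊆ , absorb)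
        -- Since `degK w ≤ d`, the hull adds at most `suc (r * d)` vertices, the allowance per
        -- vertex of `P`.
        (≤-trans (∣p∪q∣≤∣p∣+∣q∣ (hull w) M)
          (≤-trans (ℕ.+-mono-≤ (≤-trans (∣hull∣ w) (s≤s (ℕ.*-monoʳ-≤ r small))) ∣M∣)
            (≤-reflexive (sym (cong (_* suc (r * d)) ∣wP∣)))))
      where
      ∣wP∣ : ∣ ⁅ w ⁆ ∪ P ∣ ≡ suc ∣ P ∣
      ∣wP∣ = ∣⁅x⁆∪p∣ {w} {P} w∼P
      P⊆ : ⁅ w ⁆ ∪ P ⊆ hull w ∪ M
      P⊆ x∈ with y∈⁅x⁆∪p⁻ w P x∈
      ... | inj₁ refl = x∈p∪q⁺ (inj₁ (x∈⁅x⁆∪p w _))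
      ... | inj₂ x∈P  = x∈p∪q⁺ (inj₂ (proj₁ abs x∈P))
      absorb : ∀ {v q} → v ∈ ⁅ w ⁆ ∪ P → IsK A r q → v ∈ q → q ⊆ hull w ∪ M
      absorb v∈ K v∈q x∈q with y∈⁅x⁆∪p⁻ w P v∈
      ... | inj₁ refl = x∈p∪q⁺ (inj₁ (hull-upper K v∈q x∈q))
      ... | inj₂ v∈P  = x∈p∪q⁺ (inj₂ (proj₂ abs v∈P K v∈q x∈q))

    -- Distributing the copies of K_r over the vertices outside `M`.

    c : ℕ
    c = t C k

    module _ (M : Subset n) where

      -- The scale `r` keeps all weights integral. A copy inside `M` also gets share `r`, but
      -- `weight` hands it to no vertex.
      share : Subset n → ℕ
      share p = if does (∣ p ∩ ∁ M ∣ ℕ.≤? 1) then r else 1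

      1≤share : ∀ p → 1 ≤ share p
      1≤share p with does (∣ p ∩ ∁ M ∣ ℕ.≤? 1)
      ... | true  = s≤s z≤n
      ... | false = ≤-refl

      share≡r : ∀ p → ∣ p ∩ ∁ M ∣ ≤ 1 → share p ≡ r
      share≡r p ≤1 rewrite dec-true (∣ p ∩ ∁ M ∣ ℕ.≤? 1) ≤1 = refl

      share≡1 : ∀ p → ¬ (∣ p ∩ ∁ M ∣ ≤ 1) → share p ≡ 1
      share≡1 p ≰1 rewrite dec-false (∣ p ∩ ∁ M ∣ ℕ.≤? 1) ≰1 = refl

      weight : Fin n → Subset n → ℕ
      weight w p = 𝟙 (isK? A r p) * (share p * 𝟙 (w ∈? p ∩ ∁ M))

      weight≡share : ∀ {w p} → IsK A r p → w ∈ p → w ∉ M → weight w p ≡ share p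
      weight≡share {w} {p} K w∈p w∉M
        rewrite 𝟙-yes (isK? A r p) K | 𝟙-yes (w ∈? p ∩ ∁ M) (x∈p∩q⁺ (w∈p , x∉p⇒x∈∁p w∉M)) =
        trans (ℕ.+-identityʳ _) (ℕ.*-identityʳ _)

      -- A copy gives `r` to at most one vertex, or 1 to each of at most `r` vertices.
      Σweight≤ : ∀ p → Σᶠ (λ w → weight w p) ≤ r * 𝟙 (isK? A r p)
      Σweight≤ p = begin
        Σᶠ (λ w → weight w p)
          ≡⟨ *-distribˡ-sum (𝟙 (isK? A r p)) (λ w → share p * 𝟙 (w ∈? p ∩ ∁ M)) ⟨
        𝟙 (isK? A r p) * Σᶠ (λ w → share p * 𝟙 (w ∈? p ∩ ∁ M))
          ≡⟨ cong (𝟙 (isK? A r p) *_) (trans (sym (*-distribˡ-sum (share p) (λ w → 𝟙 (w ∈? p ∩ ∁ M)))) (cong (share p *_) (Σᶠ-∈ (p ∩ ∁ M)))) ⟩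
        𝟙 (isK? A r p) * (share p * ∣ p ∩ ∁ M ∣)
          ≤⟨ bound (isK? A r p) ⟩
        r * 𝟙 (isK? A r p) ∎
        where
        open ≤-Reasoning
        bound : (d : Dec (IsK A r p)) → 𝟙 d * (share p * ∣ p ∩ ∁ M ∣) ≤ r * 𝟙 d
        bound (no _) = z≤n
        bound (yes (∣p∣ , _)) with ∣ p ∩ ∁ M ∣ ℕ.≤? 1
        ... | yes ≤1 rewrite share≡r p ≤1 = ≤-trans (≤-reflexive (ℕ.+-identityʳ _)) (ℕ.*-monoʳ-≤ r ≤1)
        ... | no ≰1 rewrite share≡1 p ≰1 = begin
          1 * ∣ p ∩ ∁ M ∣ + 0  ≡⟨ trans (ℕ.+-identityʳ _) (ℕ.*-identityˡ _) ⟩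
          ∣ p ∩ ∁ M ∣          ≤⟨ ∣p∩q∣≤∣p∣ p (∁ M) ⟩
          ∣ p ∣                ≡⟨ trans ∣p∣ (sym (ℕ.*-identityʳ r)) ⟩
          r * 1                ∎

      -- Each copy at `w` gives it at least 1, so a degree above `r * c` suffices; this is why
      -- `r * c` is the degree bound of the greedy choice.
      Σweight≥-largeDegree : ∀ {w} → w ∉ M → r * c < degK w → suc (r * c) ≤ Σₛ (weight w)
      Σweight≥-largeDegree {w} w∉M large = ≤-trans large (sum-mono le (allSubsets n))
        where
        le : ∀ p → 𝟙 (Kat? w p) ≤ weight w p
        le p = go (Kat? w p)
          where
          go : (d : Dec (IsK A r p × w ∈ p)) → 𝟙 d ≤ weight w p
          go (no _) = z≤n
          go (yes (K , w∈p)) = ≤-trans (1≤share p) (≤-reflexive (sym (weight≡share K w∈p w∉M)))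

      -- The `k`-subsets of `s` yield `c` copies worth `r` each to `w`, and `q` is a further copy
      -- worth at least 1.
      Σweight≥-extraClique : ∀ {w s q} → w ∉ M → ∣ s ∣ ≡ t → Clique A s → w ∼ s → s ⊆ M →
        IsK A r q → w ∈ q → q ⊈ ⁅ w ⁆ ∪ s → suc (r * c) ≤ Σₛ (weight w)
      Σweight≥-extraClique {w} {s} {q} w∉M ∣s∣ cs w∼s s⊆M K w∈q q⊈ = begin
        suc (r * c)
          ≡⟨ ℕ.+-comm 1 (r * c) ⟩
        r * c + 1
          -- The summand 1 is written as the sum of the indicator of `q`, so that both terms can be
          -- compared with `weight w` set by set.
          ≡⟨ cong₂ (λ a b → r * a + b)
               (count-between ⁅ w ⁆ ws t k (λ x∈ → x∈p∪q⁺ (inj₁ x∈))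
                 (trans (∣⁅x⁆∪p∣ {w} {s} w∼s) (trans (cong suc ∣s∣) (trans (ℕ.+-comm 1 t) (cong (t +_) (sym (∣⁅x⁆∣≡1 w)))))))
               (trans (count-between q q 0 0 id refl) (nC0≡1 0)) ⟨
        r * Σₛ (λ p → 𝟙 (between? ⁅ w ⁆ ws k p)) + Σₛ (λ p → 𝟙 (between? q q 0 p))
          ≡⟨ cong (_+ Σₛ (λ p → 𝟙 (between? q q 0 p))) (sum-* r _ (allSubsets n)) ⟨
        Σₛ (λ p → r * 𝟙 (between? ⁅ w ⁆ ws k p)) + Σₛ (λ p → 𝟙 (between? q q 0 p))
          ≡⟨ sum-+ (λ p → r * 𝟙 (between? ⁅ w ⁆ ws k p)) (λ p → 𝟙 (between? q q 0 p)) (allSubsets n) ⟨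
        Σₛ (λ p → r * 𝟙 (between? ⁅ w ⁆ ws k p) + 𝟙 (between? q q 0 p))
          ≤⟨ sum-mono (λ p → le p (between? ⁅ w ⁆ ws k p) (between? q q 0 p)) (allSubsets n) ⟩
        Σₛ (weight w) ∎
        where
        open ≤-Reasoning
        ws = ⁅ w ⁆ ∪ s
        le : ∀ p (d : Dec (Between ⁅ w ⁆ ws k p)) (e : Dec (Between q q 0 p)) → r * 𝟙 d + 𝟙 e ≤ weight w p
        -- No copy is counted in both families, as `q` is not contained in `ws`.
        le p (yes (_ , _ , p⊆)) (yes (_ , q⊆p , _)) = ⊥-elim (q⊈ λ x∈q → p⊆ (q⊆p x∈q))
        le p (no _) (no _) = ≤-trans (≤-reflexive (trans (ℕ.+-identityʳ _) (ℕ.*-zeroʳ r))) z≤n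
        le p (no _) (yes (_ , q⊆p , p⊆q)) with refl ← ⊆-antisym q⊆p p⊆q =
          ≤-trans (≤-reflexive (cong (_+ 1) (ℕ.*-zeroʳ r)))
            (≤-trans (1≤share q) (≤-reflexive (sym (weight≡share K w∈q w∉M))))
        le p (yes (∣p∣ , w⊆p , p⊆)) (no _) = ≤-reflexive (trans (trans (ℕ.+-identityʳ _) (ℕ.*-identityʳ r))
          (sym (trans (weight≡share {w} {p} Kp (w⊆p (x∈⁅x⁆ w)) w∉M) (share≡r p (≤-trans (p⊆q⇒∣p∣≤∣q∣ only-w) (≤-reflexive (∣⁅x⁆∣≡1 w)))))))
          where
          Kp : IsK A r p
          Kp = trans ∣p∣ (trans (cong (k +_) (∣⁅x⁆∣≡1 w)) (ℕ.+-comm k 1)) , Clique-⊆ p⊆ (Clique-∪ {w} {s} w∼s cs)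
          only-w : p ∩ ∁ M ⊆ ⁅ w ⁆
          only-w {x} x∈ with x∈p∩q⁻ p (∁ M) x∈
          ... | x∈p , x∈∁M with x∈p∪q⁻ ⁅ w ⁆ s (p⊆ x∈p)
          ...   | inj₁ x∈w = x∈w
          ...   | inj₂ x∈s = contradiction (s⊆M x∈s) (x∈∁p⇒x∉p x∈∁M)

    Extremal : Set
    Extremal = ∃ λ T → ∣ T ∣ ≡ t × IsJoin A T

    -- If a vertex of small degree has no copy of K_r leaving `⁅ w ⁆ ∪ s`, then `isJoin` identifies
    -- the whole graph.
    Σweight≥ : ∀ {M} → Covers (r * c) M → ∀ w → w ∉ M → Extremal ⊎ suc (r * c) ≤ Σₛ (weight M w)
    Σweight≥ {M} covers w w∉M with degK w ℕ.≤? r * c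
    ... | no large = inj₂ (Σweight≥-largeDegree M w∉M (ℕ.≰⇒> large))
    ... | yes small with covers w w∉M small
    ...   | s , ∣s∣ , cs , w∼s , s⊆M
      with anySubset? (λ q → isK? A r q ×-dec (w ∈? q) ×-dec ¬? (q ⊆? (⁅ w ⁆ ∪ s)))
    ...     | yes (q , K , w∈q , q⊈) = inj₂ (Σweight≥-extraClique M w∉M ∣s∣ cs w∼s s⊆M K w∈q q⊈)
    ...     | no none = inj₁ (s , ∣s∣ , isJoin ∣s∣ cs w∼s only)
      where
      only : ∀ {q} → IsK A r q → w ∈ q → q ⊆ ⁅ w ⁆ ∪ s
      only {q} K w∈q = decidable-stable (q ⊆? (⁅ w ⁆ ∪ s)) λ q⊈ → none (q , K , w∈q , q⊈)

    -- Double counting of weights: every vertex outside the bounded set `M` receives at least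
    -- `suc (r * c)`, and every copy gives out at most `r`.
    extremal⊎manyCopies : Extremal ⊎ (n ∸ r * suc (r * (r * c))) * suc (r * c) ≤ r * copiesK r A
    extremal⊎manyCopies
      with M , ∣M∣ , covers ← greedy (r * c) r ⊥ ⊥ (λ i∈ → contradiction i∈ ∉⊥) (cong (_+ r) (∣⊥∣≡0 n))
             (id , λ v∈ → contradiction v∈ ∉⊥) (≤-trans (≤-reflexive (∣⊥∣≡0 n)) z≤n)
      with all⊎ (λ w → atVertex {M} covers w)
      where
      atVertex : ∀ {M} → Covers (r * c) M → ∀ w → Extremal ⊎ 𝟙 (w ∈? ∁ M) * suc (r * c) ≤ Σₛ (weight M w)
      atVertex {M} covers w = go (w ∈? ∁ M)
        where
        go : (d : Dec (w ∈ ∁ M)) → Extremal ⊎ 𝟙 d * suc (r * c) ≤ Σₛ (weight M w)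
        go (no _)  = inj₂ z≤n
        go (yes w∈∁M) with Σweight≥ {M} covers w (x∈∁p⇒x∉p w∈∁M)
        ... | inj₁ ext = inj₁ ext
        ... | inj₂ ge  = inj₂ (≤-trans (≤-reflexive (ℕ.+-identityʳ _)) ge)
    ... | inj₁ ext = inj₁ ext
    ... | inj₂ ge  = inj₂ (begin
      (n ∸ r * suc (r * (r * c))) * suc (r * c)
        ≤⟨ ℕ.*-monoˡ-≤ (suc (r * c)) (≤-trans (ℕ.∸-monoʳ-≤ n ∣M∣) (≤-reflexive (sym (∣∁p∣≡n∸∣p∣ M)))) ⟩
      ∣ ∁ M ∣ * suc (r * c)
        ≡⟨ cong (_* suc (r * c)) (Σᶠ-∈ (∁ M)) ⟨
      Σᶠ (λ w → 𝟙 (w ∈? ∁ M)) * suc (r * c)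
        ≡⟨ *-distribʳ-sum (suc (r * c)) (λ w → 𝟙 (w ∈? ∁ M)) ⟩
      Σᶠ (λ w → 𝟙 (w ∈? ∁ M) * suc (r * c))
        ≤⟨ Σᶠ-mono ge ⟩
      Σᶠ (λ w → Σₛ (weight M w))
        ≡⟨ Σᶠ-sum-comm (weight M) (allSubsets n) ⟩
      Σₛ (λ p → Σᶠ (λ w → weight M w p))
        ≤⟨ sum-mono (Σweight≤ M) (allSubsets n) ⟩
      Σₛ (λ p → r * 𝟙 (isK? A r p))
        ≡⟨ sum-* r _ (allSubsets n) ⟩
      r * copiesK r A ∎)
      where open ≤-Reasoning

-- Comparison of the two counts for large `n`.

module _ (k t : ℕ) where

  private
    r = suc k
    c = t C k
    -- The bound from `greedy` on the absorbing set, for the degree bound `r * c`.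
    m = r * suc (r * (r * c))
    -- What `fewCopies` leaves over after `n` is written as `d + m` and the terms in `d` cancel.
    excess = 2 * r * (m * c + t C r) + m

  threshold : ℕ
  threshold = suc (2 + t + m + excess)

  satNumber : ℕ → ℕ
  satNumber n = (n ∸ (2 + t) + 2) * c + t C r

  -- Truncated subtraction makes this depend on `2 + t ≤ n`, which `threshold` ensures.
  n∸t≡n∸s+2 : ∀ {n} → threshold ≤ n → n ∸ t ≡ n ∸ (2 + t) + 2
  n∸t≡n∸s+2 {n} large = begin
    n ∸ t              ≡⟨ cong (_∸ t) (ℕ.m∸n+n≡m s≤n) ⟨
    n ∸ (2 + t) + (2 + t) ∸ t  ≡⟨ cong (_∸ t) (ℕ.+-assoc (n ∸ (2 + t)) 2 t) ⟨
    n ∸ (2 + t) + 2 + t ∸ t  ≡⟨ ℕ.m+n∸n≡m _ t ⟩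
    n ∸ (2 + t) + 2    ∎
    where
    open ≡-Reasoning
    s≤n : 2 + t ≤ n
    s≤n = ≤-trans (≤-trans (ℕ.m≤m+n (2 + t) m) (ℕ.m≤m+n _ excess)) (≤-trans (ℕ.n≤1+n _) large)

  copies-join : ∀ {n} {A : Adj n} T → threshold ≤ n → ∣ T ∣ ≡ t → IsJoin A T → copiesK r A ≡ satNumber n
  copies-join T large refl J = trans (Join.copies T J k) (cong (λ d → d * c + t C r) (n∸t≡n∸s+2 large))

  -- With `d = n ∸ m`, doubling the lower bound yields `2 * d` beyond the main term
  -- `2 * r * (d * c)`, while the upper bound allows only `d + excess`. So `d ≤ excess`, against
  -- `threshold`.
  fewCopies : ∀ {n X} → threshold ≤ n → 2 * r * X ≤ 2 * r * satNumber n + n →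
    ¬ ((n ∸ m) * suc (r * c) ≤ r * X)
  fewCopies {n} {X} large few many = ℕ.<⇒≱ (≤-trans (ℕ.m≤n+m (suc excess) (2 + t)) d-large) d-small
    where
    open ≤-Reasoning
    d = n ∸ m
    d-large : 2 + t + suc excess ≤ d
    d-large = ℕ.m+n≤o⇒m≤o∸n (2 + t + suc excess) (≤-trans (≤-reflexive (rearrange (2 + t) m excess)) large)
      where
      rearrange : ∀ a b e → a + suc e + b ≡ suc (a + b + e)
      rearrange = solve-∀
    m≤n : m ≤ n
    m≤n = ≤-trans (≤-trans (ℕ.m≤n+m m (2 + t)) (ℕ.m≤m+n _ excess)) (≤-trans (ℕ.n≤1+n _) large)
    n≡d+m : n ≡ d + m
    n≡d+m = sym (ℕ.m∸n+n≡m m≤n)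
    sat≤ : satNumber n ≤ n * c + t C r
    sat≤ = ℕ.+-monoˡ-≤ (t C r) (ℕ.*-monoˡ-≤ c (≤-trans (≤-reflexive (sym (n∸t≡n∸s+2 large))) (ℕ.m∸n≤m n t)))
    d-small : d ≤ excess
    d-small = ℕ.+-cancelˡ-≤ (2 * r * (d * c) + d) d excess (begin
      2 * r * (d * c) + d + d             ≡⟨ lhs r c d ⟩
      2 * (d * suc (r * c))               ≤⟨ ℕ.*-monoʳ-≤ 2 many ⟩
      2 * (r * X)                         ≡⟨ ℕ.*-assoc 2 r X ⟨
      2 * r * X                           ≤⟨ few ⟩
      2 * r * satNumber n + n             ≤⟨ ℕ.+-monoˡ-≤ n (ℕ.*-monoʳ-≤ (2 * r) sat≤) ⟩
      2 * r * (n * c + t C r) + n         ≡⟨ cong (λ n → 2 * r * (n * c + t C r) + n) n≡d+m ⟩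
      2 * r * ((d + m) * c + t C r) + (d + m)  ≡⟨ rhs r c d m (t C r) ⟩
      2 * r * (d * c) + d + excess        ∎)
      where
      lhs : ∀ r c d → 2 * r * (d * c) + d + d ≡ 2 * (d * suc (r * c))
      lhs = solve-∀
      rhs : ∀ r c d m e → 2 * r * ((d + m) * c + e) + (d + m) ≡ 2 * r * (d * c) + d + (2 * r * (m * c + e) + m)
      rhs = solve-∀

theorem1p3 : ∀ (r s : ℕ) → 2 ≤ r → r < s →
    Σ ℕ λ n₀ → Σ ℕ λ p → Σ ℕ λ q → 1 ≤ p × 1 ≤ q ×
    (∀ n → n₀ ≤ n →
    IsSat n r s ((n ∸ s + 2) * ((s ∸ 2) C (r ∸ 1)) + (s ∸ 2) C r) ×
    (∀ (A : Adj n) → Saturated s A → ∀ m → IsSat n r s m →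
    q * copiesK r A ≤ q * m + p * n →
    Isomorphic A (joinCliqueIndep n (s ∸ 2))))
theorem1p3 (suc k) (suc (suc t)) (s≤s 1≤k) (s≤s (s≤s k≤t)) =
  -- The constant c_{r,s} is the fraction 1/(2r), given by its numerator and denominator.
  threshold k t , 1 , 2 * suc k , ≤-refl , s≤s z≤n , λ n large →
    ((joinCliqueIndep n t , join-saturated large , join-copies large) , λ A sat → lower large sat) ,
    λ A sat m isSat few → isomorphic large sat (≤-trans few
      (≤-trans (ℕ.+-monoˡ-≤ (1 * n) (ℕ.*-monoʳ-≤ (2 * suc k) (sat≤ large isSat)))
        (≤-reflexive (cong (2 * suc k * satNumber k t n +_) (ℕ.*-identityˡ n)))))
  where
  module _ {n} (large : threshold k t ≤ n) where

    t≤n : t ≤ n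
    t≤n = ≤-trans (≤-trans (ℕ.m≤n+m t 2) (ℕ.m≤m+n _ _)) (≤-trans (ℕ.m≤m+n _ _) (≤-trans (ℕ.n≤1+n _) large))

    join-saturated : Saturated (2 + t) (joinCliqueIndep n t)
    join-saturated = subst (λ a → Saturated (2 + a) (joinCliqueIndep n t)) (∣initial∣ t≤n)
      (Join.saturated (initial n t) (joinCliqueIndep-isJoin n t))

    join-copies : copiesK (suc k) (joinCliqueIndep n t) ≡ satNumber k t n
    join-copies = copies-join k t (initial n t) large (∣initial∣ t≤n) (joinCliqueIndep-isJoin n t)

    -- Minimality of `m`, tested on the join, turns a bound in terms of `m` into one in terms of
    -- `satNumber`.
    sat≤ : ∀ {m} → IsSat n (suc k) (2 + t) m → m ≤ satNumber k t n
    sat≤ (_ , min) = ≤-trans (min (joinCliqueIndep n t) join-saturated) (≤-reflexive join-copies)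

    module _ {A : Adj n} (sat : Saturated (2 + t) A) where

      extremal : 2 * suc k * copiesK (suc k) A ≤ 2 * suc k * satNumber k t n + n → ∃ λ T → ∣ T ∣ ≡ t × IsJoin A T
      extremal few with Saturation.extremal⊎manyCopies sat 1≤k k≤t
      ... | inj₁ ext  = ext
      ... | inj₂ many = contradiction many (fewCopies k t large few)

      isomorphic : 2 * suc k * copiesK (suc k) A ≤ 2 * suc k * satNumber k t n + n → Isomorphic A (joinCliqueIndep n t)
      isomorphic few with T , refl , J ← extremal few = join-isomorphic T J

      -- A graph with fewer copies would satisfy the hypothesis of `extremal`, hence be the join and
      -- have exactly `satNumber` copies.
      lower : satNumber k t n ≤ copiesK (suc k) A
      lower with satNumber k t n ℕ.≤? copiesK (suc k) A
      ... | yes le = le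
      ... | no  ≰ =
        let T , ∣T∣ , J = extremal (≤-trans (ℕ.*-monoʳ-≤ (2 * suc k) (ℕ.<⇒≤ (ℕ.≰⇒> ≰))) (ℕ.m≤m+n _ n))
        in ≤-reflexive (sym (copies-join k t T large ∣T∣ J))
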